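{- Let $n$ be a positive integer with $n\equiv 16 \pmod{24}$. Then there exists a configuration $(2,4)$ $GDD\left(n,2,6;\frac{7n}{8},n-1\right)$.
   Context: A $GDD(n,2,6;\lambda_1,\lambda_2)$ is a finite collection (repetitions allowed) of $6$-element subsets, called blocks, of a $2n$-element set $X$ partitioned into two groups of size $n$, such that every point lies in the same number $r$ of blocks, any two distinct points of the same group lie together in exactly $\lambda_1$ blocks, and any two points from different groups lie together in exactly $\lambda_2$ blocks. It has configuration $(2,4)$ if every block has exactly $2$ points in one of the two groups and $4$ points in the other (which group contains the $2$ points may depend on the block). -}

module Defs where

open import Data.Fin using (Fin; _≟_)
open import Data.Fin.Subset using (Subset; _∩_; ∣_∣)
open import Data.Fin.Subset.Properties using (_∈?_)
open import Data.List using (List; filter; length)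
open import Data.List.Relation.Unary.All using (All)
open import Data.Nat using (ℕ; _*_)
open import Data.Product using (∃₂; _×_)
open import Data.Vec using (tabulate)
open import Relation.Binary.PropositionalEquality using (_≡_; _≢_)
open import Relation.Nullary using (does)
open import Relation.Nullary.Decidable using (_×-dec_)

replication : ∀ {v} → List (Subset v) → Fin v → ℕ
replication blocks x = length (filter (λ B → x ∈? B) blocks)

concurrence : ∀ {v} → List (Subset v) → Fin v → Fin v → ℕ
concurrence blocks x y =
  length (filter (λ B → (x ∈? B) ×-dec (y ∈? B)) blocks)

-- The partition of the points into m groups is given by the map sending a
-- point to the index of its group.
fibre : ∀ {v m} → (Fin v → Fin m) → Fin m → Subset v
fibre f i = tabulate (λ x → does (f x ≟ i))

-- GDD(n, m, k; λ₁, λ₂).  The blocks form a multiset, represented by a list: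
-- repeated blocks are allowed and are counted with multiplicity.
record GDD (n m k λ₁ λ₂ : ℕ) : Set where
  field
    groupOf         : Fin (m * n) → Fin m
    groupSize       : ∀ i → ∣ fibre groupOf i ∣ ≡ n
    blocks          : List (Subset (m * n))
    blockSize       : All (λ B → ∣ B ∣ ≡ k) blocks
    r               : ℕ
    equireplicate   : ∀ x → replication blocks x ≡ r
    sameGroup       : ∀ x y → x ≢ y → groupOf x ≡ groupOf y →
                      concurrence blocks x y ≡ λ₁
    differentGroups : ∀ x y → groupOf x ≢ groupOf y →
                      concurrence blocks x y ≡ λ₂

  group : Fin m → Subset (m * n)
  group = fibre groupOf

-- Since i and j are chosen separately for each block, which of the two groups
-- contains the s points may depend on the block.
HasConfiguration : ∀ {n k λ₁ λ₂} → ℕ → ℕ → GDD n 2 k λ₁ λ₂ → Set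
HasConfiguration s t D =
  All (λ B → ∃₂ λ i j → i ≢ j × ∣ B ∩ group i ∣ ≡ s × ∣ B ∩ group j ∣ ≡ t)
      blocks
  where open GDD D

{-# OPTIONS --safe #-}
module Submission where

-- Write n = 8m, where m ≡ 2 (mod 3), and split each group into four classes of 2m points.  A block is
-- a quad in one group joined to an edge of the other.  It suffices to arrange, for each of the two
-- positions of the quads, (quad, edge) pairs such that two points of a group lie in 6m quads and in
-- m edges, and such that the two contributions to each pair of points from different groups add up
-- to 8m - 1.
--
-- Quads with two points in each of two classes are unions of two edges from the same factor of a
-- 1-factorization of K_{2m}; matching the two factors cyclically resolves them into partial parallel
-- classes that cover both classes once, and each partial class is paired with one edge between two
-- classes.  This edge is taken between the same two classes in one position and between the other
-- two classes in the other position, which balances the contributions.  The remaining quads are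
-- transversals of the four classes, coming from a difference matrix over ℤ_m with an extra parity
-- bit: its rows are (k, 2k, 3k + ω, ω) with ω ∈ {0, 1}, whose differences k, 2k ± ω, 3k cover ℤ_m
-- uniformly because 3 is a unit and 2k + ω runs through 0, …, 2m - 1.  The translates of one row with
-- fixed parities cover half of the points.  The edges left over form the graph K_{2m} □ K_4 of even
-- degree 2m + 2, and they are distributed so that the edges at each point come in couples that are
-- assigned complementary halves.

open import Defs
open import Data.Bool using (Bool; true; false; not; _∧_; _xor_; if_then_else_)
open import Data.Empty using (⊥-elim)
open import Data.Fin using (Fin; zero; suc; toℕ; combine; quotient; remainder; _↑ˡ_; _↑ʳ_)
import Data.Fin as Fin
open import Data.Fin.Patterns
open import Data.Fin.Properties using (combine-remQuot; remQuot-combine; toℕ-injective; toℕ<n)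
open import Data.Fin.Subset using (Subset; _∩_; ∣_∣)
open import Data.Fin.Subset.Properties using (_∈?_)
open import Data.List using (List; []; _∷_; _++_; map; concatMap; upTo; applyUpTo; allFin; tabulate; filter; length)
open import Data.List.Relation.Unary.All using (All; []; _∷_)
import Data.List.Relation.Unary.All as All
import Data.List.Relation.Unary.All.Properties as Allₚ
open import Data.Nat
open import Data.Nat.DivMod
open import Data.Nat.Properties
open import Data.Nat.Tactic.RingSolver using (solve-∀)
open import Data.Product using (_×_; _,_; proj₁; proj₂; ∃; ∃₂; Σ-syntax)
open import Data.Product.Properties using (≡-dec)
open import Data.Sum using (inj₁; inj₂)
import Data.Vec as Vec
open import Function using (_∘_; id; case_of_)
open import Relation.Binary.PropositionalEquality
open import Relation.Nullary using (Dec; yes; no; does)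
open import Relation.Nullary.Decidable using (map′; _×-dec_; from-yes)

private variable
  X Y : Set

-- Finite sums

∑ : List X → (X → ℕ) → ℕ
∑ []       f = 0
∑ (x ∷ xs) f = f x + ∑ xs f

infix 6.5 ∑
syntax ∑ xs (λ x → e) = ∑[ x ∈ xs ] e

∑-cong-All : ∀ {xs : List X} {f g} → All (λ x → f x ≡ g x) xs → ∑ xs f ≡ ∑ xs g
∑-cong-All []       = refl
∑-cong-All (e ∷ es) = cong₂ _+_ e (∑-cong-All es)

∑-cong : ∀ (xs : List X) {f g} → (∀ x → f x ≡ g x) → ∑ xs f ≡ ∑ xs g
∑-cong []       e = refl
∑-cong (x ∷ xs) e = cong₂ _+_ (e x) (∑-cong xs e)

∑-cong-< : ∀ n {f g : ℕ → ℕ} → (∀ i → i < n → f i ≡ g i) → ∑ (upTo n) f ≡ ∑ (upTo n) g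
∑-cong-< n e = ∑-cong-All (Allₚ.applyUpTo⁺₁ id n (e _))

+-interchange : ∀ p q r s → (p + q) + (r + s) ≡ (p + r) + (q + s)
+-interchange = solve-∀

∑-+ : ∀ (xs : List X) f g → ∑[ x ∈ xs ] (f x + g x) ≡ ∑ xs f + ∑ xs g
∑-+ []       f g = refl
∑-+ (x ∷ xs) f g = trans (cong (f x + g x +_) (∑-+ xs f g)) (+-interchange (f x) (g x) _ _)

∑-*ˡ : ∀ k (xs : List X) f → ∑[ x ∈ xs ] (k * f x) ≡ k * ∑ xs f
∑-*ˡ k []       f = sym (*-zeroʳ k)
∑-*ˡ k (x ∷ xs) f = trans (cong (k * f x +_) (∑-*ˡ k xs f)) (sym (*-distribˡ-+ k (f x) _))

∑-*ʳ : ∀ k (xs : List X) f → ∑[ x ∈ xs ] (f x * k) ≡ ∑ xs f * k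
∑-*ʳ k []       f = refl
∑-*ʳ k (x ∷ xs) f = trans (cong (f x * k +_) (∑-*ʳ k xs f)) (sym (*-distribʳ-+ k (f x) _))

∑-zero : ∀ (xs : List X) → ∑[ x ∈ xs ] 0 ≡ 0
∑-zero []       = refl
∑-zero (x ∷ xs) = ∑-zero xs

∑-swap : ∀ (xs : List X) (ys : List Y) (f : X → Y → ℕ) →
         ∑[ x ∈ xs ] ∑[ y ∈ ys ] f x y ≡ ∑[ y ∈ ys ] ∑[ x ∈ xs ] f x y
∑-swap []       ys f = sym (∑-zero ys)
∑-swap (x ∷ xs) ys f =
  trans (cong (∑ ys (f x) +_) (∑-swap xs ys f)) (sym (∑-+ ys (f x) _))

∑-++ : ∀ (xs ys : List X) f → ∑ (xs ++ ys) f ≡ ∑ xs f + ∑ ys f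
∑-++ []       ys f = refl
∑-++ (x ∷ xs) ys f = trans (cong (f x +_) (∑-++ xs ys f)) (sym (+-assoc (f x) _ _))

∑-map : ∀ (g : X → Y) xs f → ∑ (map g xs) f ≡ ∑[ x ∈ xs ] f (g x)
∑-map g []       f = refl
∑-map g (x ∷ xs) f = cong (f (g x) +_) (∑-map g xs f)

∑-concatMap : ∀ (g : X → List Y) xs f → ∑ (concatMap g xs) f ≡ ∑[ x ∈ xs ] ∑ (g x) f
∑-concatMap g []       f = refl
∑-concatMap g (x ∷ xs) f =
  trans (∑-++ (g x) (concatMap g xs) f) (cong (∑ (g x) f +_) (∑-concatMap g xs f))

∑-applyUpTo : ∀ (g : ℕ → X) n f → ∑ (applyUpTo g n) f ≡ ∑[ i ∈ upTo n ] f (g i)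
∑-applyUpTo g zero    f = refl
∑-applyUpTo g (suc n) f = cong (f (g 0) +_)
  (trans (∑-applyUpTo (g ∘ suc) n f) (sym (∑-applyUpTo suc n (f ∘ g))))

∑-suc : ∀ n (f : ℕ → ℕ) → ∑ (upTo (suc n)) f ≡ f 0 + ∑[ i ∈ upTo n ] f (suc i)
∑-suc n f = cong (f 0 +_) (∑-applyUpTo suc n f)

∑-const : ∀ n (k : ℕ) → ∑[ i ∈ upTo n ] k ≡ n * k
∑-const zero    k = refl
∑-const (suc n) k = trans (∑-suc n (λ _ → k)) (cong (k +_) (∑-const n k))

∑-upTo-+ : ∀ m n (f : ℕ → ℕ) → ∑ (upTo (m + n)) f ≡ ∑ (upTo m) f + ∑[ i ∈ upTo n ] f (m + i)
∑-upTo-+ zero    n f = refl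
∑-upTo-+ (suc m) n f = begin
  ∑ (upTo (suc (m + n))) f                                     ≡⟨ ∑-suc (m + n) f ⟩
  f 0 + ∑ (upTo (m + n)) (f ∘ suc)                             ≡⟨ cong (f 0 +_) (∑-upTo-+ m n (f ∘ suc)) ⟩
  f 0 + (∑ (upTo m) (f ∘ suc) + ∑[ i ∈ upTo n ] f (suc m + i)) ≡⟨ +-assoc (f 0) _ _ ⟨
  f 0 + ∑ (upTo m) (f ∘ suc) + ∑[ i ∈ upTo n ] f (suc m + i)   ≡⟨ cong (_+ ∑ (upTo n) (λ i → f (suc m + i))) (∑-suc m f) ⟨
  ∑ (upTo (suc m)) f + ∑[ i ∈ upTo n ] f (suc m + i)           ∎
  where open ≡-Reasoning

∑-last : ∀ n (f : ℕ → ℕ) → ∑ (upTo (suc n)) f ≡ ∑ (upTo n) f + f n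
∑-last n f = begin
  ∑ (upTo (suc n)) f                         ≡⟨ cong (λ k → ∑ (upTo k) f) (+-comm n 1) ⟨
  ∑ (upTo (n + 1)) f                         ≡⟨ ∑-upTo-+ n 1 f ⟩
  ∑ (upTo n) f + (f (n + 0) + 0)             ≡⟨ cong (∑ (upTo n) f +_) (+-identityʳ _) ⟩
  ∑ (upTo n) f + f (n + 0)                   ≡⟨ cong (λ k → ∑ (upTo n) f + f k) (+-identityʳ n) ⟩
  ∑ (upTo n) f + f n                         ∎
  where open ≡-Reasoning

∑-reverse : ∀ n (f : ℕ → ℕ) → ∑[ i ∈ upTo n ] f (n ∸ suc i) ≡ ∑ (upTo n) f
∑-reverse zero    f = refl
∑-reverse (suc n) f = begin
  ∑[ i ∈ upTo (suc n) ] f (n ∸ i)            ≡⟨ ∑-suc n (λ i → f (n ∸ i)) ⟩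
  f n + ∑[ i ∈ upTo n ] f (n ∸ suc i)        ≡⟨ cong (f n +_) (∑-reverse n f) ⟩
  f n + ∑ (upTo n) f                         ≡⟨ +-comm (f n) _ ⟩
  ∑ (upTo n) f + f n                         ≡⟨ ∑-last n f ⟨
  ∑ (upTo (suc n)) f                         ∎
  where open ≡-Reasoning

-- Even and odd indices are separated because they are coupled later: the values 2k and 2k + 1, and
-- the factors 2g and 2g + 1.
∑-upTo-2* : ∀ n (f : ℕ → ℕ) → ∑ (upTo (2 * n)) f ≡ ∑[ i ∈ upTo n ] (f (2 * i) + f (1 + 2 * i))
∑-upTo-2* zero    f = refl
∑-upTo-2* (suc n) f = begin
  ∑ (upTo (2 * suc n)) f
    ≡⟨ cong (λ k → ∑ (upTo k) f) (2*suc n) ⟩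
  ∑ (upTo (suc (suc (2 * n)))) f
    ≡⟨ trans (∑-last (suc (2 * n)) f) (cong (_+ f (1 + 2 * n)) (∑-last (2 * n) f)) ⟩
  ∑ (upTo (2 * n)) f + f (2 * n) + f (1 + 2 * n)
    ≡⟨ cong (λ s → s + f (2 * n) + f (1 + 2 * n)) (∑-upTo-2* n f) ⟩
  ∑[ i ∈ upTo n ] (f (2 * i) + f (1 + 2 * i)) + f (2 * n) + f (1 + 2 * n)
    ≡⟨ +-assoc (∑[ i ∈ upTo n ] (f (2 * i) + f (1 + 2 * i))) _ _ ⟩
  ∑[ i ∈ upTo n ] (f (2 * i) + f (1 + 2 * i)) + (f (2 * n) + f (1 + 2 * n))
    ≡⟨ ∑-last n (λ i → f (2 * i) + f (1 + 2 * i)) ⟨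
  ∑[ i ∈ upTo (suc n) ] (f (2 * i) + f (1 + 2 * i)) ∎
  where
  open ≡-Reasoning
  2*suc : ∀ n → 2 * suc n ≡ suc (suc (2 * n))
  2*suc = solve-∀

term≤∑ : ∀ n (f : ℕ → ℕ) {i} → i < n → f i ≤ ∑ (upTo n) f
term≤∑ (suc n) f {zero}  _         = m≤m+n (f 0) _
term≤∑ (suc n) f {suc i} (s≤s i<n) = begin
  f (suc i)                           ≤⟨ term≤∑ n (f ∘ suc) i<n ⟩
  ∑[ j ∈ upTo n ] f (suc j)           ≤⟨ m≤n+m _ (f 0) ⟩
  f 0 + ∑[ j ∈ upTo n ] f (suc j)     ≡⟨ ∑-suc n f ⟨
  ∑ (upTo (suc n)) f                  ∎
  where open ≤-Reasoning

-- Opaque, so that sums over it stay folded and unification can see them.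
opaque
  bools : List Bool
  bools = false ∷ true ∷ []

  ∑-bools : ∀ f → ∑ bools f ≡ f false + f true
  ∑-bools f = cong (f false +_) (+-identityʳ (f true))

  All-bools : ∀ {P : Bool → Set} → (∀ b → P b) → All P bools
  All-bools p = p false ∷ p true ∷ []

opaque
  -- With values in ℕ, conjunctions of equations become products and numbers of solutions become
  -- sums.
  δ : ℕ → ℕ → ℕ
  δ a b = if a ≡ᵇ b then 1 else 0

  δ-≡ : ∀ {a b} → a ≡ b → δ a b ≡ 1
  δ-≡ {a} refl = lemma a
    where
    lemma : ∀ a → (if a ≡ᵇ a then 1 else 0) ≡ 1
    lemma zero    = refl
    lemma (suc a) = lemma a

  δ-≢ : ∀ {a b} → a ≢ b → δ a b ≡ 0
  δ-≢ {zero}  {zero}  ne = ⊥-elim (ne refl)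
  δ-≢ {zero}  {suc b} ne = refl
  δ-≢ {suc a} {zero}  ne = refl
  δ-≢ {suc a} {suc b} ne = δ-≢ (ne ∘ cong suc)

δ-⇔ : ∀ {a b c d} → (a ≡ b → c ≡ d) → (c ≡ d → a ≡ b) → δ a b ≡ δ c d
δ-⇔ {a} {b} {c} {d} f g with a ≟ b
... | yes e = trans (δ-≡ e) (sym (δ-≡ (f e)))
... | no ne = trans (δ-≢ ne) (sym (δ-≢ (ne ∘ g)))

δ-sym : ∀ a b → δ a b ≡ δ b a
δ-sym a b = δ-⇔ sym sym

δ≤1 : ∀ a b → δ a b ≤ 1
δ≤1 a b with a ≟ b
... | yes e = ≤-reflexive (δ-≡ e)
... | no ne = ≤-trans (≤-reflexive (δ-≢ ne)) z≤n

δ-exclusive : ∀ {a b} e → a ≢ b → δ e a * δ e b ≡ 0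
δ-exclusive {a} {b} e ne with e ≟ a
... | yes refl = trans (cong (δ e e *_) (δ-≢ ne)) (*-zeroʳ (δ e e))
... | no  e≢a  = cong (_* δ e b) (δ-≢ e≢a)

∑-δ : ∀ n (f : ℕ → ℕ) {i} → i < n → ∑[ j ∈ upTo n ] (δ i j * f j) ≡ f i
∑-δ (suc n) f {i} i<n = trans (∑-suc n (λ j → δ i j * f j)) (go i i<n)
  where
  open ≡-Reasoning
  go : ∀ i → i < suc n → δ i 0 * f 0 + ∑[ j ∈ upTo n ] (δ i (suc j) * f (suc j)) ≡ f i
  go zero    _         = begin
    δ 0 0 * f 0 + ∑[ j ∈ upTo n ] (δ 0 (suc j) * f (suc j))
      ≡⟨ cong₂ _+_ (cong (_* f 0) (δ-≡ {0} refl)) (∑-cong (upTo n) (λ j → cong (_* f (suc j)) (δ-≢ {0} λ ()))) ⟩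
    f 0 + 0 + ∑[ j ∈ upTo n ] 0
      ≡⟨ cong₂ _+_ (+-identityʳ (f 0)) (∑-zero (upTo n)) ⟩
    f 0 + 0
      ≡⟨ +-identityʳ (f 0) ⟩
    f 0 ∎
  go (suc i) (s≤s i<n) = begin
    δ (suc i) 0 * f 0 + ∑[ j ∈ upTo n ] (δ (suc i) (suc j) * f (suc j))
      ≡⟨ cong₂ _+_ (cong (_* f 0) (δ-≢ {suc i} λ ())) (∑-cong (upTo n) (λ j → cong (_* f (suc j)) (δ-⇔ {suc i} suc-injective (cong suc)))) ⟩
    ∑[ j ∈ upTo n ] (δ i j * f (suc j))
      ≡⟨ ∑-δ n (f ∘ suc) i<n ⟩
    f (suc i) ∎

-- Counting reduces to this: a unique solution turns the sum into one value of `f`, and the constant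
-- 1 for `f` gives the count itself.
∑-unique : ∀ n (p q f : ℕ → ℕ) {i} → i < n → p i ≡ q i → (∀ j → j < n → p j ≡ q j → j ≡ i) →
           ∑[ j ∈ upTo n ] (δ (p j) (q j) * f j) ≡ f i
∑-unique n p q f {i} i<n pᵢ≡qᵢ unique = trans (∑-cong-< n same) (∑-δ n f i<n)
  where
  same : ∀ j → j < n → δ (p j) (q j) * f j ≡ δ i j * f j
  same j j<n = cong (_* f j) (δ-⇔ (λ e → sym (unique j j<n e)) λ { refl → pᵢ≡qᵢ })

-- Residues

module Modular (M : ℕ) .{{_ : NonZero M}} where

  infix 4 _≈_
  _≈_ : ℕ → ℕ → Set
  a ≈ b = a % M ≡ b % M

  %-≈ : ∀ a → a % M ≈ a
  %-≈ a = m%n%n≡m%n a M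

  ≈-+ : ∀ {a b c d} → a ≈ b → c ≈ d → a + c ≈ b + d
  ≈-+ {a} {b} {c} {d} e f = begin
    (a + c) % M            ≡⟨ %-distribˡ-+ a c M ⟩
    (a % M + c % M) % M    ≡⟨ cong₂ (λ x y → (x + y) % M) e f ⟩
    (b % M + d % M) % M    ≡⟨ %-distribˡ-+ b d M ⟨
    (b + d) % M            ∎
    where open ≡-Reasoning

  ≈-*ˡ : ∀ c {a b} → a ≈ b → c * a ≈ c * b
  ≈-*ˡ c {a} {b} e = begin
    (c * a) % M            ≡⟨ %-distribˡ-* c a M ⟩
    (c % M * (a % M)) % M  ≡⟨ cong (λ x → (c % M * x) % M) e ⟩
    (c % M * (b % M)) % M  ≡⟨ %-distribˡ-* c b M ⟨
    (c * b) % M            ∎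
    where open ≡-Reasoning

  +kM-≈ : ∀ a k → a + k * M ≈ a
  +kM-≈ a k = [m+kn]%n≡m%n a k M

  ≈-< : ∀ {a b} → a < M → b < M → a ≈ b → a ≡ b
  ≈-< a<M b<M e = trans (sym (m<n⇒m%n≡m a<M)) (trans e (m<n⇒m%n≡m b<M))

  -- `c * pred M` serves as -c, since c + c(M - 1) = cM. This gives cancellation without integers.
  +-pred-≈ : ∀ a c → a + c + c * pred M ≈ a
  +-pred-≈ a c = trans (cong (_% M) eq) (+kM-≈ a c)
    where
    open ≡-Reasoning
    eq : a + c + c * pred M ≡ a + c * M
    eq = begin
      a + c + c * pred M    ≡⟨ +-assoc a c _ ⟩
      a + (c + c * pred M)  ≡⟨ cong (a +_) (*-suc c (pred M)) ⟨
      a + c * suc (pred M)  ≡⟨ cong (λ k → a + c * k) (suc-pred M) ⟩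
      a + c * M             ∎

  ≈-cancelʳ : ∀ {a b} c → a + c ≈ b + c → a ≈ b
  ≈-cancelʳ {a} {b} c e =
    trans (sym (+-pred-≈ a c)) (trans (≈-+ e refl) (+-pred-≈ b c))

  ≈-cancelˡ : ∀ c {a b} → c + a ≈ c + b → a ≈ b
  ≈-cancelˡ c {a} {b} e =
    ≈-cancelʳ c (trans (cong (_% M) (+-comm a c)) (trans e (cong (_% M) (+-comm c b))))

  -- Invertibility as an explicit equation in ℕ, which the ring solver can verify in concrete cases.
  record Unit (c : ℕ) : Set where
    constructor unit
    field
      c⁻¹ r : ℕ
      inv   : c * c⁻¹ ≡ 1 + r * M

  unit-1 : Unit 1
  unit-1 = unit 1 0 refl

  affine-injective : ∀ {c} → Unit c → ∀ u {i j} → i < M → j < M → u + c * i ≈ u + c * j → i ≡ j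
  affine-injective {c} (unit c⁻¹ r inv) u {i} {j} i<M j<M e =
    ≈-< i<M j<M (trans (sym (back i)) (trans (≈-*ˡ c⁻¹ (≈-cancelˡ u e)) (back j)))
    where
    open ≡-Reasoning
    rearrange : ∀ r i M → (1 + r * M) * i ≡ i + (r * i) * M
    rearrange = solve-∀
    assoc : ∀ c d i → d * (c * i) ≡ c * d * i
    assoc = solve-∀
    back : ∀ i → c⁻¹ * (c * i) ≈ i
    back i = begin
      (c⁻¹ * (c * i)) % M    ≡⟨ cong (_% M) (assoc c c⁻¹ i) ⟩
      (c * c⁻¹ * i) % M      ≡⟨ cong (λ k → (k * i) % M) inv ⟩
      ((1 + r * M) * i) % M  ≡⟨ cong (_% M) (rearrange r i M) ⟩
      (i + (r * i) * M) % M  ≡⟨ +kM-≈ i (r * i) ⟩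
      i % M                  ∎

  affine-solution : ∀ {c} → Unit c → ∀ u w → ∃ λ i → i < M × u + c * i ≈ w
  affine-solution {c} (unit c⁻¹ r inv) u w = t % M , m%n<n t M , solves
    where
    open ≡-Reasoning
    y t : ℕ
    -- `y` stands for w - u, so `t` is c⁻¹(w - u).
    y = w + u * pred M
    t = c⁻¹ * y
    rearrange : ∀ u w r M p → u + (1 + r * M) * (w + u * p) ≡ w + u + u * p + (r * (w + u * p)) * M
    rearrange = solve-∀
    solves : u + c * (t % M) ≈ w
    solves = begin
      (u + c * (t % M)) % M          ≡⟨ ≈-+ {u} refl (≈-*ˡ c (%-≈ t)) ⟩
      (u + c * (c⁻¹ * y)) % M        ≡⟨ cong (λ k → (u + k) % M) (*-assoc c c⁻¹ y) ⟨
      (u + c * c⁻¹ * y) % M          ≡⟨ cong (λ k → (u + k * y) % M) inv ⟩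
      (u + (1 + r * M) * y) % M      ≡⟨ cong (_% M) (rearrange u w r M (pred M)) ⟩
      (w + u + u * pred M + (r * y) * M) % M  ≡⟨ +kM-≈ _ (r * y) ⟩
      (w + u + u * pred M) % M       ≡⟨ +-pred-≈ w u ⟩
      w % M                          ∎

  ∑-affine : ∀ {c} → Unit c → ∀ u w (f : ℕ → ℕ) → ∃ λ i → i < M × u + c * i ≈ w ×
             ∑[ j ∈ upTo M ] (δ ((u + c * j) % M) (w % M) * f j) ≡ f i
  ∑-affine {c} uc u w f =
    let i , i<M , e = affine-solution uc u w
    in  i , i<M , e ,
        ∑-unique M (λ j → (u + c * j) % M) (λ _ → w % M) f i<M e
          (λ j j<M e′ → affine-injective uc u j<M i<M (trans e′ (sym e)))

  count-affine : ∀ {c} → Unit c → ∀ u w → ∑[ j ∈ upTo M ] δ ((u + c * j) % M) (w % M) ≡ 1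
  count-affine uc u w =
    let _ , _ , _ , e = ∑-affine uc u w (λ _ → 1)
    in  trans (∑-cong (upTo M) (λ j → sym (*-identityʳ _))) e

  ∑-translate : ∀ A {x} (f : ℕ → ℕ) → x < M → ∃ λ i → i < M × i + A ≈ x ×
                ∑[ j ∈ upTo M ] (δ ((j + A) % M) x * f j) ≡ f i
  ∑-translate A {x} f x<M =
    let i , i<M , e , s = ∑-affine unit-1 A x f
    in  i , i<M , trans (cong (_% M) (flip i)) e ,
        trans (∑-cong (upTo M) (λ j → cong (_* f j)
                (cong₂ δ (cong (_% M) (flip j)) (sym (m<n⇒m%n≡m x<M))))) s
    where
    flip : ∀ i → i + A ≡ A + 1 * i
    flip i = trans (+-comm i A) (cong (A +_) (sym (*-identityˡ i)))

  count-translate : ∀ A {x} → x < M → ∑[ j ∈ upTo M ] δ ((j + A) % M) x ≡ 1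
  count-translate A x<M =
    let _ , _ , _ , s = ∑-translate A (λ _ → 1) x<M
    in  trans (∑-cong (upTo M) (λ j → sym (*-identityʳ _))) s

  -- The first condition forces j = x - A; the second then compares the difference of the points
  -- with that of the offsets. This is how a row of a difference matrix is tested on two points.
  count-two-translates : ∀ A B {x y} → x < M → y < M →
    ∑[ j ∈ upTo M ] (δ ((j + A) % M) x * δ ((j + B) % M) y) ≡ δ ((x + B) % M) ((y + A) % M)
  count-two-translates A B {x} {y} x<M y<M =
    let i , i<M , e , s = ∑-translate A (λ j → δ ((j + B) % M) y) x<M
    in  trans s (δ-⇔ (to i e) (from i e))
    where
    open ≡-Reasoning
    comm : ∀ i a b → i + a + b ≡ i + b + a
    comm = solve-∀
    to : ∀ i → i + A ≈ x → (i + B) % M ≡ y → x + B ≈ y + A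
    to i e e′ = begin
      (x + B) % M      ≡⟨ ≈-+ e refl ⟨
      (i + A + B) % M  ≡⟨ cong (_% M) (comm i A B) ⟩
      (i + B + A) % M  ≡⟨ ≈-+ {i + B} {y} (trans e′ (sym (m<n⇒m%n≡m y<M))) refl ⟩
      (y + A) % M      ∎
    from : ∀ i → i + A ≈ x → x + B ≈ y + A → (i + B) % M ≡ y
    from i e e′ = trans (≈-cancelʳ A (begin
      (i + B + A) % M  ≡⟨ cong (_% M) (comm i B A) ⟩
      (i + A + B) % M  ≡⟨ ≈-+ e refl ⟩
      (x + B) % M      ≡⟨ e′ ⟩
      (y + A) % M      ∎)) (m<n⇒m%n≡m y<M)

  -- A translation hits every residue once: expand `f` by `δ`, exchange the sums and count.
  ∑-shift : ∀ A (f : ℕ → ℕ) → ∑[ i ∈ upTo M ] f ((i + A) % M) ≡ ∑ (upTo M) f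
  ∑-shift A f = begin
    ∑[ i ∈ upTo M ] f ((i + A) % M)
      ≡⟨ ∑-cong (upTo M) (λ i → ∑-δ M f (m%n<n (i + A) M)) ⟨
    ∑[ i ∈ upTo M ] ∑[ x ∈ upTo M ] (δ ((i + A) % M) x * f x)
      ≡⟨ ∑-swap (upTo M) (upTo M) (λ i x → δ ((i + A) % M) x * f x) ⟩
    ∑[ x ∈ upTo M ] ∑[ i ∈ upTo M ] (δ ((i + A) % M) x * f x)
      ≡⟨ ∑-cong-< M (λ x x<M → trans (∑-*ʳ (f x) (upTo M) (λ i → δ ((i + A) % M) x))
           (trans (cong (_* f x) (count-translate A x<M)) (*-identityˡ (f x)))) ⟩
    ∑ (upTo M) f ∎
    where open ≡-Reasoning

  -- 2k and 2k + 1 for k < M run once through 0, …, 2M - 1.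
  count-doubles : ∀ u w → ∑[ k ∈ upTo M ] (δ ((u + 2 * k) % M) (w % M) + δ ((u + (1 + 2 * k)) % M) (w % M)) ≡ 2
  count-doubles u w = begin
    ∑[ k ∈ upTo M ] (f (2 * k) + f (1 + 2 * k))       ≡⟨ ∑-upTo-2* M f ⟨
    ∑ (upTo (2 * M)) f                                ≡⟨ cong (λ k → ∑ (upTo k) f) (cong (M +_) (+-identityʳ M)) ⟩
    ∑ (upTo (M + M)) f                                ≡⟨ ∑-upTo-+ M M f ⟩
    ∑ (upTo M) f + ∑[ l ∈ upTo M ] f (M + l)          ≡⟨ cong (∑ (upTo M) f +_) (∑-cong (upTo M) periodic) ⟩
    ∑ (upTo M) f + ∑ (upTo M) f                       ≡⟨ cong₂ _+_ once once ⟩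
    2 ∎
    where
    open ≡-Reasoning
    f : ℕ → ℕ
    f l = δ ((u + l) % M) (w % M)
    move : ∀ u l M → u + (M + l) ≡ u + l + 1 * M
    move = solve-∀
    periodic : ∀ l → f (M + l) ≡ f l
    periodic l = cong (λ k → δ k (w % M)) (trans (cong (_% M) (move u l M)) (+kM-≈ (u + l) 1))
    once : ∑ (upTo M) f ≡ 1
    once = trans (∑-cong (upTo M) (λ l → cong (λ k → δ ((u + k) % M) (w % M)) (sym (*-identityˡ l))))
                 (count-affine unit-1 u w)

-- 1-factorizations of complete graphs

a+b≤1⇒a*b≡0 : ∀ a b → a + b ≤ 1 → a * b ≡ 0
a+b≤1⇒a*b≡0 zero          b       _        = refl
a+b≤1⇒a*b≡0 (suc zero)    zero    _        = refl
a+b≤1⇒a*b≡0 (suc zero)    (suc b) (s≤s ())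
a+b≤1⇒a*b≡0 (suc (suc a)) b       (s≤s ())

-- The points are the residues modulo v = 2h + 1 together with a point at infinity, encoded as v.
-- The factor j consists of {j, ∞} and of the pairs {j + q, j - q} with 1 ≤ q ≤ h.
module OneFactorization (h m v : ℕ) .{{_ : NonZero v}} (m≡ : m ≡ suc h) (v≡ : v ≡ suc (2 * h)) where
  open Modular v

  -- The two ends of the edge `q` of the factor `j`. Since 2h ≡ -1 modulo v, adding
  -- `suc q * (2 * h)` subtracts `suc q`; the edge 0 ends at infinity.
  E : ℕ → ℕ → Bool → ℕ
  E j q       false = (j + q) % v
  E j zero    true  = v
  E j (suc q) true  = (j + suc q * (2 * h)) % v

  on : ℕ → ℕ → ℕ → ℕ
  on j q z = δ (E j q false) z + δ (E j q true) z

  joins : ℕ → ℕ → ℕ → ℕ → ℕ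
  joins j q x y = δ (E j q false) x * δ (E j q true) y + δ (E j q true) x * δ (E j q false) y

  E-< : ∀ j q σ → E j q σ < suc v
  E-< j q       false = m<n⇒m<1+n (m%n<n _ v)
  E-< j zero    true  = n<1+n v
  E-< j (suc q) true  = m<n⇒m<1+n (m%n<n _ v)

  ∑-factor : ∀ f → ∑ (upTo m) f ≡ f 0 + ∑[ i ∈ upTo h ] f (suc i)
  ∑-factor f = trans (cong (λ k → ∑ (upTo k) f) m≡) (∑-suc h f)

  -- q = 0 gives a central term, while q and v - q give the same pair {j + q, j - q} with its ends
  -- exchanged. A sum over residues thus becomes a sum over the h finite edges in both orientations.
  ∑-fold : ∀ j (g : ℕ → ℕ → ℕ) →
    ∑[ q ∈ upTo v ] g ((j + q) % v) ((j + q * (2 * h)) % v) ≡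
    g ((j + 0) % v) ((j + 0) % v) +
    ∑[ i ∈ upTo h ] (g (E j (suc i) false) (E j (suc i) true) + g (E j (suc i) true) (E j (suc i) false))
  ∑-fold j g = begin
    ∑ (upTo v) f
      ≡⟨ cong (λ k → ∑ (upTo k) f) v≡ ⟩
    ∑ (upTo (suc (2 * h))) f
      ≡⟨ ∑-suc (2 * h) f ⟩
    f 0 + ∑ (upTo (2 * h)) (f ∘ suc)
      ≡⟨ cong (λ k → f 0 + ∑ (upTo k) (f ∘ suc)) (cong (h +_) (+-identityʳ h)) ⟩
    f 0 + ∑ (upTo (h + h)) (f ∘ suc)
      ≡⟨ cong (f 0 +_) (∑-upTo-+ h h (f ∘ suc)) ⟩
    f 0 + (∑[ i ∈ upTo h ] f (suc i) + ∑[ i ∈ upTo h ] f (suc (h + i)))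
      -- Reversing the upper half brings `suc i` together with v - `suc i`.
      ≡⟨ cong (λ s → f 0 + (∑[ i ∈ upTo h ] f (suc i) + s)) (∑-reverse h (λ i → f (suc (h + i)))) ⟨
    f 0 + (∑[ i ∈ upTo h ] f (suc i) + ∑[ i ∈ upTo h ] f (suc (h + (h ∸ suc i))))
      ≡⟨ cong (λ s → f 0 + s) (∑-+ (upTo h) (λ i → f (suc i)) _) ⟨
    f 0 + ∑[ i ∈ upTo h ] (f (suc i) + f (suc (h + (h ∸ suc i))))
      ≡⟨ cong (f 0 +_) (∑-cong-< h (λ i i<h → cong (f (suc i) +_) (cong₂ g (minus i i<h) (plus i i<h)))) ⟩
    f 0 + ∑[ i ∈ upTo h ] (g (E j (suc i) false) (E j (suc i) true) + g (E j (suc i) true) (E j (suc i) false)) ∎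
    where
    open ≡-Reasoning
    f : ℕ → ℕ
    f q = g ((j + q) % v) ((j + q * (2 * h)) % v)
    opposite : ∀ i → i < h → suc (h + (h ∸ suc i)) + suc i ≡ v
    opposite i i<h = begin
      suc (h + (h ∸ suc i)) + suc i    ≡⟨ cong suc (+-assoc h (h ∸ suc i) (suc i)) ⟩
      suc (h + (h ∸ suc i + suc i))    ≡⟨ cong (λ k → suc (h + k)) (trans (m∸n+n≡m i<h) (sym (+-identityʳ h))) ⟩
      suc (2 * h)                      ≡⟨ v≡ ⟨
      v                                ∎
    negate : ∀ q → j + q * (2 * h) + q ≈ j
    negate q = trans (cong (_% v) (trans (lemma j q h) (cong (λ k → j + q * k) (sym v≡)))) (+kM-≈ j q)
      where
      lemma : ∀ j q h → j + q * (2 * h) + q ≡ j + q * suc (2 * h)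
      lemma = solve-∀
    sum≈ : ∀ a b → a + b ≡ v → j + a + b ≈ j
    sum≈ a b e = trans (cong (_% v) (trans (+-assoc j a b) (cong (j +_) (trans e (sym (*-identityˡ v)))))) (+kM-≈ j 1)
    minus : ∀ i → i < h → j + suc (h + (h ∸ suc i)) ≈ j + suc i * (2 * h)
    minus i i<h = ≈-cancelʳ (suc i) (trans (sum≈ _ (suc i) (opposite i i<h)) (sym (negate (suc i))))
    plus : ∀ i → i < h → j + suc (h + (h ∸ suc i)) * (2 * h) ≈ j + suc i
    plus i i<h = ≈-cancelʳ q′ (trans (negate q′) (sym (sum≈ (suc i) q′ (trans (+-comm (suc i) q′) (opposite i i<h)))))
      where
      q′ : ℕ
      q′ = suc (h + (h ∸ suc i))

  private
    %≢v : ∀ a → a % v ≢ v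
    %≢v a = <⇒≢ (m%n<n a v)

    v≢ : ∀ {z} → z < v → v ≢ z
    v≢ z<v = ≢-sym (<⇒≢ z<v)

    δ-%v : ∀ a → δ (a % v) v ≡ 0
    δ-%v a = δ-≢ (%≢v a)

  -- Every factor is a perfect matching: infinity lies on the edge 0 only, and by `∑-fold` the
  -- finite ends run once through the residues j + q.
  count-on : ∀ j z → z < suc v → ∑[ q ∈ upTo m ] on j q z ≡ 1
  count-on j z z<2m with m<1+n⇒m<n∨m≡n z<2m
  ... | inj₁ z<v = begin
    ∑[ q ∈ upTo m ] on j q z
      ≡⟨ ∑-factor (λ q → on j q z) ⟩
    δ ((j + 0) % v) z + δ v z + ∑[ i ∈ upTo h ] on j (suc i) z
      ≡⟨ cong (_+ ∑[ i ∈ upTo h ] on j (suc i) z) (trans (cong (δ ((j + 0) % v) z +_) (δ-≢ (v≢ z<v))) (+-identityʳ _)) ⟩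
    δ ((j + 0) % v) z + ∑[ i ∈ upTo h ] on j (suc i) z
      ≡⟨ ∑-fold j (λ a _ → δ a z) ⟨
    ∑[ q ∈ upTo v ] δ ((j + q) % v) z
      ≡⟨ ∑-cong (upTo v) (λ q → cong (λ k → δ (k % v) z) (+-comm j q)) ⟩
    ∑[ q ∈ upTo v ] δ ((q + j) % v) z
      ≡⟨ count-translate j z<v ⟩
    1 ∎
    where open ≡-Reasoning
  ... | inj₂ refl = begin
    ∑[ q ∈ upTo m ] on j q v
      ≡⟨ ∑-factor (λ q → on j q v) ⟩
    δ ((j + 0) % v) v + δ v v + ∑[ i ∈ upTo h ] on j (suc i) v
      ≡⟨ cong₂ _+_ (cong₂ _+_ (δ-%v (j + 0)) (δ-≡ refl))
           (trans (∑-cong (upTo h) (λ i → cong₂ _+_ (δ-%v (j + suc i)) (δ-%v (j + suc i * (2 * h))))) (∑-zero (upTo h))) ⟩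
    1 ∎
    where open ≡-Reasoning

  on≤1 : ∀ j q z → q < m → z < suc v → on j q z ≤ 1
  on≤1 j q z q<m z<2m = ≤-trans (term≤∑ m (λ q → on j q z) q<m) (≤-reflexive (count-on j z z<2m))

  -- An edge with both ends at `z` would give `on` the value 2 there.
  joins-self : ∀ j q z → q < m → z < suc v → joins j q z z ≡ 0
  joins-self j q z q<m z<2m = cong₂ _+_ zer (trans (*-comm (δ (E j q true) z) _) zer)
    where
    zer : δ (E j q false) z * δ (E j q true) z ≡ 0
    zer = a+b≤1⇒a*b≡0 (δ (E j q false) z) (δ (E j q true) z) (on≤1 j q z q<m z<2m)

  -- One end cannot be at two different points, so only the mixed terms of the product survive.
  on*on≡joins : ∀ j q {x y} → x ≢ y → on j q x * on j q y ≡ joins j q x y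
  on*on≡joins j q {x} {y} x≢y = begin
    (a x + b x) * (a y + b y)
      ≡⟨ expand (a x) (b x) (a y) (b y) ⟩
    a x * a y + b x * b y + (a x * b y + b x * a y)
      ≡⟨ cong (_+ joins j q x y) (cong₂ _+_ (δ-exclusive (E j q false) x≢y) (δ-exclusive (E j q true) x≢y)) ⟩
    joins j q x y ∎
    where
    open ≡-Reasoning
    a b : ℕ → ℕ
    a z = δ (E j q false) z
    b z = δ (E j q true) z
    expand : ∀ a b c d → (a + b) * (c + d) ≡ a * c + b * d + (a * d + b * c)
    expand = solve-∀

  joins-sym : ∀ j q x y → joins j q x y ≡ joins j q y x
  joins-sym j q x y = lemma (δ (E j q false) x) (δ (E j q true) y) (δ (E j q true) x) (δ (E j q false) y)
    where
    lemma : ∀ a b c d → a * b + c * d ≡ d * c + b * a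
    lemma = solve-∀

  private
    unit-2 : Unit 2
    -- 2(h + 1) = 1 + v, so h + 1 is the inverse of 2.
    unit-2 = unit (suc h) 1 (trans (lemma h) (cong (λ k → 1 + 1 * k) (sym v≡)))
      where
      lemma : ∀ h → 2 * suc h ≡ 1 + 1 * suc (2 * h)
      lemma = solve-∀

    -- In the factor `j` infinity is joined to `j` alone, so only the factor `y` counts.
    count-joins-∞ : ∀ y → y < v → ∑[ j ∈ upTo v ] ∑[ q ∈ upTo m ] joins j q v y ≡ 1
    count-joins-∞ y y<v = trans (∑-cong (upTo v) inner) (count-translate 0 y<v)
      where
      open ≡-Reasoning
      inner : ∀ j → ∑[ q ∈ upTo m ] joins j q v y ≡ δ ((j + 0) % v) y
      inner j = begin
        ∑[ q ∈ upTo m ] joins j q v y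
          ≡⟨ ∑-factor (λ q → joins j q v y) ⟩
        δ ((j + 0) % v) v * δ v y + δ v v * δ ((j + 0) % v) y + ∑[ i ∈ upTo h ] joins j (suc i) v y
          ≡⟨ cong₂ _+_ (cong₂ _+_ (cong (_* δ v y) (δ-%v (j + 0))) (trans (cong (_* δ ((j + 0) % v) y) (δ-≡ refl)) (+-identityʳ _)))
               (trans (∑-cong (upTo h) (λ i → cong₂ _+_ (cong (_* δ (E j (suc i) true) y) (δ-%v (j + suc i)))
                  (cong (_* δ (E j (suc i) false) y) (δ-%v (j + suc i * (2 * h)))))) (∑-zero (upTo h))) ⟩
        δ ((j + 0) % v) y + 0
          ≡⟨ +-identityʳ _ ⟩
        δ ((j + 0) % v) y ∎

    -- {x, y} lies in the factor j exactly when 2j ≡ x + y.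
    count-joins-finite : ∀ x y → x < v → y < v → x ≢ y → ∑[ j ∈ upTo v ] ∑[ q ∈ upTo m ] joins j q x y ≡ 1
    count-joins-finite x y x<v y<v x≢y = trans (∑-cong (upTo v) inner) (count-affine unit-2 0 (x + y))
      where
      open ≡-Reasoning
      g : ℕ → ℕ → ℕ
      g a b = δ a x * δ b y
      -- Here `i` is x - j, hence the other end j - i is 2j - x, which is `y` exactly when 2j ≡ x +
      -- y.
      double : ∀ j → ∃ (λ i → i < v × i + j ≈ x × ∑[ q ∈ upTo v ] (δ ((q + j) % v) x * δ ((j + q * (2 * h)) % v) y) ≡ δ ((j + i * (2 * h)) % v) y) →
               ∑[ q ∈ upTo v ] (δ ((q + j) % v) x * δ ((j + q * (2 * h)) % v) y) ≡ δ ((2 * j) % v) ((x + y) % v)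
      double j (i , _ , e , s) = trans s (δ-⇔ to from)
        where
        cancel : j + i * (2 * h) + i ≈ j
        cancel = trans (cong (_% v) (trans (lemma j i h) (cong (λ k → j + i * k) (sym v≡)))) (+kM-≈ j i)
          where
          lemma : ∀ j q h → j + q * (2 * h) + q ≡ j + q * suc (2 * h)
          lemma = solve-∀
        comm : ∀ i j y → i + j + y ≡ y + i + j
        comm = solve-∀
        two : ∀ j → 2 * j ≡ j + j
        two = solve-∀
        to : (j + i * (2 * h)) % v ≡ y → 2 * j ≈ x + y
        to e′ = begin
          (2 * j) % v                    ≡⟨ cong (_% v) (two j) ⟩
          (j + j) % v                    ≡⟨ ≈-+ cancel refl ⟨
          (j + i * (2 * h) + i + j) % v  ≡⟨ ≈-+ (≈-+ {j + i * (2 * h)} {y} (trans e′ (sym (m<n⇒m%n≡m y<v))) refl) refl ⟩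
          (y + i + j) % v                ≡⟨ cong (_% v) (comm i j y) ⟨
          (i + j + y) % v                ≡⟨ ≈-+ e refl ⟩
          (x + y) % v                    ∎
        from : 2 * j ≈ x + y → (j + i * (2 * h)) % v ≡ y
        from e′ = trans (≈-cancelʳ i (≈-cancelʳ j (begin
          (j + i * (2 * h) + i + j) % v  ≡⟨ ≈-+ cancel refl ⟩
          (j + j) % v                    ≡⟨ cong (_% v) (two j) ⟨
          (2 * j) % v                    ≡⟨ e′ ⟩
          (x + y) % v                    ≡⟨ ≈-+ e refl ⟨
          (i + j + y) % v                ≡⟨ cong (_% v) (comm i j y) ⟩
          (y + i + j) % v                ∎))) (m<n⇒m%n≡m y<v)
      inner : ∀ j → ∑[ q ∈ upTo m ] joins j q x y ≡ δ ((2 * j) % v) ((x + y) % v)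
      inner j = begin
        ∑[ q ∈ upTo m ] joins j q x y
          ≡⟨ ∑-factor (λ q → joins j q x y) ⟩
        joins j 0 x y + ∑[ i ∈ upTo h ] joins j (suc i) x y
          -- The edge to infinity joins no two finite points, and the central term of `∑-fold`
          -- vanishes because `x ≢ y`; both are 0 and may be exchanged.
          ≡⟨ cong (_+ ∑[ i ∈ upTo h ] joins j (suc i) x y) (trans
               (cong₂ _+_ (trans (cong (δ ((j + 0) % v) x *_) (δ-≢ (v≢ y<v))) (*-zeroʳ (δ ((j + 0) % v) x)))
                          (cong (_* δ ((j + 0) % v) y) (δ-≢ (v≢ x<v))))
               (sym (δ-exclusive ((j + 0) % v) x≢y))) ⟩
        g ((j + 0) % v) ((j + 0) % v) + ∑[ i ∈ upTo h ] joins j (suc i) x y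
          ≡⟨ ∑-fold j g ⟨
        ∑[ q ∈ upTo v ] g ((j + q) % v) ((j + q * (2 * h)) % v)
          ≡⟨ ∑-cong (upTo v) (λ q → cong (λ k → δ (k % v) x * δ ((j + q * (2 * h)) % v) y) (+-comm j q)) ⟩
        ∑[ q ∈ upTo v ] (δ ((q + j) % v) x * δ ((j + q * (2 * h)) % v) y)
          ≡⟨ double j (∑-translate j (λ q → δ ((j + q * (2 * h)) % v) y) x<v) ⟩
        δ ((2 * j) % v) ((x + y) % v) ∎

  count-joins : ∀ x y → x < suc v → y < suc v → x ≢ y → ∑[ j ∈ upTo v ] ∑[ q ∈ upTo m ] joins j q x y ≡ 1
  count-joins x y x< y< x≢y with m<1+n⇒m<n∨m≡n x< | m<1+n⇒m<n∨m≡n y<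
  ... | inj₁ x<v  | inj₁ y<v  = count-joins-finite x y x<v y<v x≢y
  ... | inj₂ refl | inj₁ y<v  = count-joins-∞ y y<v
  ... | inj₁ x<v  | inj₂ refl =
    trans (∑-cong (upTo v) (λ j → ∑-cong (upTo m) (λ q → joins-sym j q x v))) (count-joins-∞ x x<v)
  ... | inj₂ refl | inj₂ refl = ⊥-elim (x≢y refl)

-- Transversal quads

∀Bool? : {P : Bool → Set} → (∀ b → Dec (P b)) → Dec (∀ b → P b)
∀Bool? P? = map′ (λ { (pf , pt) false → pf ; (pf , pt) true → pt }) (λ p → p false , p true)
                 (P? false ×-dec P? true)

bit : Bool → ℕ
bit false = 0
bit true  = 1

δᵇ : Bool → Bool → ℕ
δᵇ false b = bit (not b)
δᵇ true  b = bit b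

Class : Set
Class = Bool × Bool

δᶜ : Class → Class → ℕ
δᶜ (a , a′) (b , b′) = δᵇ a b * δᵇ a′ b′

-- (c , p , x) is the point x of ℤ_m with parity p in the class c; only x < m is meaningful.
Point : Set
Point = Class × Bool × ℕ

module Transversals (m : ℕ) .{{_ : NonZero m}} where
  open Modular m

  -- The row (k, 2k, 3k + ω, ω) with the classes numbered in binary from 0 to 3; the subscripts in
  -- `K₀₁`, `K₂₃` and the like are these numbers.
  offset : Class → Bool → ℕ → ℕ
  offset (false , false) ω k = k
  offset (false , true)  ω k = 2 * k
  offset (true  , false) ω k = bit ω + 3 * k
  offset (true  , true)  ω k = bit ω

  -- For fixed t the two values of d give complementary parities in every class.
  side : Bool → Bool → Bool → Class → Bool
  side t₂ d t₁ (a₁ , a₂) = d xor (t₁ ∧ a₁) xor (t₂ ∧ a₂)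

  transversal : Bool → Bool → Bool → ℕ → ℕ → Point → ℕ
  transversal t₂ d t₁ k i (a , p , x) = δᵇ p (side t₂ d t₁ a) * δ ((i + offset a t₂ k) % m) x

  private
    -- By `count-two-translates`, the number of rows with bit ω that have a translate through both
    -- residues. Parities are counted separately by `sides`.
    K : Class → Class → Bool → ℕ → ℕ → ℕ
    K a b ω x y = ∑[ k ∈ upTo m ] δ ((x + offset b ω k) % m) ((y + offset a ω k) % m)

    K-sym : ∀ a b ω x y → K a b ω x y ≡ K b a ω y x
    K-sym a b ω x y = ∑-cong (upTo m) (λ k → δ-sym ((x + offset b ω k) % m) ((y + offset a ω k) % m))

    δ-cancel : ∀ a b k → δ ((a + k) % m) ((b + k) % m) ≡ δ (a % m) (b % m)
    δ-cancel a b k = δ-⇔ (≈-cancelʳ k) (λ e → ≈-+ e refl)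

    -- Removing the common part αk leaves u + ck ≡ w, which has one solution because `c` is a unit.
    ∑-linear : ∀ {c} → Unit c → ∀ α u w → ∑[ k ∈ upTo m ] δ ((u + (α + c) * k) % m) ((w + α * k) % m) ≡ 1
    ∑-linear {c} uc α u w = trans (∑-cong (upTo m) (λ k →
        trans (cong (λ l → δ (l % m) ((w + α * k) % m)) (split u α c k)) (δ-cancel (u + c * k) w (α * k))))
      (count-affine uc u w)
      where
      split : ∀ u α c k → u + (α + c) * k ≡ u + c * k + α * k
      split = solve-∀

    module _ (unit-3 : Unit 3) where
      K₀₁ : ∀ ω x y → K (false , false) (false , true) ω x y ≡ 1
      K₀₁ ω x y = trans (∑-cong (upTo m) (λ k → cong (λ l → δ ((x + 2 * k) % m) ((y + l) % m)) (sym (*-identityˡ k))))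
                        (∑-linear unit-1 1 x y)

      K₀₃ : ∀ ω x y → K (false , false) (true , true) ω x y ≡ 1
      K₀₃ ω x y = trans (∑-cong (upTo m) (λ k → trans
                    (cong₂ (λ l l′ → δ (l % m) ((y + l′) % m)) (sym (+-identityʳ (x + bit ω))) (sym (*-identityˡ k)))
                    (δ-sym ((x + bit ω + 0 * k) % m) ((y + 1 * k) % m))))
                  (∑-linear unit-1 0 y (x + bit ω))

      K₂₁ : ∀ ω x y → K (true , false) (false , true) ω x y ≡ 1
      K₂₁ ω x y = trans (∑-cong (upTo m) (λ k → trans
                    (cong (λ l → δ ((x + 2 * k) % m) (l % m)) (sym (+-assoc y (bit ω) (3 * k))))
                    (δ-sym ((x + 2 * k) % m) ((y + bit ω + 3 * k) % m))))
                  (∑-linear unit-1 2 (y + bit ω) x)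

      K₂₃ : ∀ ω x y → K (true , false) (true , true) ω x y ≡ 1
      K₂₃ ω x y = trans (∑-cong (upTo m) (λ k → trans
                    (cong₂ (λ l l′ → δ (l % m) (l′ % m)) (sym (+-identityʳ (x + bit ω))) (sym (+-assoc y (bit ω) (3 * k))))
                    (δ-sym ((x + bit ω + 0 * k) % m) ((y + bit ω + 3 * k) % m))))
                  (∑-linear unit-3 0 (y + bit ω) (x + bit ω))

      -- Up to sign and a constant depending on ω, the two entries of the row differ by k or 3k.
      -- Both 1 and 3 are units, so each ω alone gives exactly one row.
      K-generic : ∀ a₁ b₁ a₂ ω x y → K (a₁ , a₂) (b₁ , not a₂) ω x y ≡ 1
      K-generic false false false = K₀₁
      K-generic false true  false = K₀₃
      K-generic true  false false = K₂₁
      K-generic true  true  false = K₂₃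
      K-generic false false true  ω x y = trans (K-sym (false , true) (false , false) ω x y) (K₀₁ ω y x)
      K-generic true  false true  ω x y = trans (K-sym (true  , true) (false , false) ω x y) (K₀₃ ω y x)
      K-generic false true  true  ω x y = trans (K-sym (false , true) (true  , false) ω x y) (K₂₁ ω y x)
      K-generic true  true  true  ω x y = trans (K-sym (true  , true) (true  , false) ω x y) (K₂₃ ω y x)

    -- The entries 3k + ω and k differ by 2k + ω, which takes every residue twice once both values
    -- of ω are used; 2 need not be a unit modulo m.
    K₀₂ : ∀ x y → ∑[ ω ∈ bools ] K (false , false) (true , false) ω x y ≡ 2
    K₀₂ x y = begin
      ∑ bools K₀₂′                    ≡⟨ ∑-bools K₀₂′ ⟩
      K₀₂′ false + K₀₂′ true         ≡⟨ ∑-+ (upTo m) _ _ ⟨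
      ∑[ k ∈ upTo m ] (δ ((x + 3 * k) % m) ((y + k) % m) + δ ((x + suc (3 * k)) % m) ((y + k) % m))
        ≡⟨ ∑-cong (upTo m) (λ k → cong₂ _+_
             (trans (cong (λ l → δ (l % m) ((y + k) % m)) (even x k)) (δ-cancel (x + 2 * k) y k))
             (trans (cong (λ l → δ (l % m) ((y + k) % m)) (odd x k)) (δ-cancel (x + (1 + 2 * k)) y k))) ⟩
      ∑[ k ∈ upTo m ] (δ ((x + 2 * k) % m) (y % m) + δ ((x + (1 + 2 * k)) % m) (y % m))
        ≡⟨ count-doubles x y ⟩
      2 ∎
      where
      open ≡-Reasoning
      K₀₂′ : Bool → ℕ
      K₀₂′ ω = K (false , false) (true , false) ω x y
      even : ∀ x k → x + 3 * k ≡ x + 2 * k + k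
      even = solve-∀
      odd : ∀ x k → x + suc (3 * k) ≡ x + (1 + 2 * k) + k
      odd = solve-∀

    K₁₃ : ∀ x y → ∑[ ω ∈ bools ] K (false , true) (true , true) ω x y ≡ 2
    K₁₃ x y = begin
      ∑ bools K₁₃′                    ≡⟨ ∑-bools K₁₃′ ⟩
      K₁₃′ false + K₁₃′ true         ≡⟨ ∑-+ (upTo m) _ _ ⟨
      ∑[ k ∈ upTo m ] (δ ((x + 0) % m) ((y + 2 * k) % m) + δ ((x + 1) % m) ((y + 2 * k) % m))
        -- The difference is now 2k - ω. Adding 1 to both sides for ω = 0 gives both cases the
        -- target x + 1, to be reached by 2k + 1 and 2k.
        ≡⟨ ∑-cong (upTo m) (λ k → trans (+-comm (δ ((x + 0) % m) ((y + 2 * k) % m)) _) (cong₂ _+_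
             (δ-sym ((x + 1) % m) ((y + 2 * k) % m))
             (trans (δ-sym ((x + 0) % m) ((y + 2 * k) % m))
               (trans (sym (δ-cancel (y + 2 * k) (x + 0) 1))
                 (cong₂ (λ l l′ → δ (l % m) (l′ % m)) (odd y k) (cong (_+ 1) (+-identityʳ x))))))) ⟩
      ∑[ k ∈ upTo m ] (δ ((y + 2 * k) % m) ((x + 1) % m) + δ ((y + (1 + 2 * k)) % m) ((x + 1) % m))
        ≡⟨ count-doubles y (x + 1) ⟩
      2 ∎
      where
      open ≡-Reasoning
      K₁₃′ : Bool → ℕ
      K₁₃′ ω = K (false , true) (true , true) ω x y
      odd : ∀ y k → y + 2 * k + 1 ≡ y + (1 + 2 * k)
      odd = solve-∀

    K-special : ∀ a₁ a₂ x y → ∑[ ω ∈ bools ] K (a₁ , a₂) (not a₁ , a₂) ω x y ≡ 2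
    K-special false false = K₀₂
    K-special false true  = K₁₃
    K-special true  false x y = trans (∑-cong bools (λ ω → K-sym (true , false) (false , false) ω x y)) (K₀₂ y x)
    K-special true  true  x y = trans (∑-cong bools (λ ω → K-sym (true , true)  (false , true)  ω x y)) (K₁₃ y x)

    sides : Bool → Bool → Bool → Class → Class → ℕ
    sides t₂ p q a b = ∑[ d ∈ bools ] ∑[ t₁ ∈ bools ] (δᵇ p (side t₂ d t₁ a) * δᵇ q (side t₂ d t₁ b))

    opaque
      unfolding bools

      -- Two prescribed parities leave 2 of the 8 triples (t₂, d, t₁). A single `t₂` may contribute
      -- 0 or 2 when a₁ = b₁, hence the sum; the matching count `K-generic` does not depend on it.
      sides-generic : ∀ p q a₁ b₁ a₂ → ∑[ t₂ ∈ bools ] sides t₂ p q (a₁ , a₂) (b₁ , not a₂) ≡ 2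
      sides-generic = from-yes (∀Bool? λ p → ∀Bool? λ q → ∀Bool? λ a₁ → ∀Bool? λ b₁ → ∀Bool? λ a₂ →
        ∑[ t₂ ∈ bools ] sides t₂ p q (a₁ , a₂) (b₁ , not a₂) ≟ 2)

      -- The parities in the two classes differ by t₁, so t₁ and then d are determined. The
      -- remaining `t₂` is also the bit ω, over which `K-special` sums.
      sides-special : ∀ p q a₁ a₂ t₂ → sides t₂ p q (a₁ , a₂) (not a₁ , a₂) ≡ 1
      sides-special = from-yes (∀Bool? λ p → ∀Bool? λ q → ∀Bool? λ a₁ → ∀Bool? λ a₂ → ∀Bool? λ t₂ →
        sides t₂ p q (a₁ , a₂) (not a₁ , a₂) ≟ 1)

  pairCount : Bool → Bool → Bool → Point → Point → ℕ
  pairCount t₂ d t₁ x y =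
    ∑[ k ∈ upTo m ] ∑[ i ∈ upTo m ] (transversal t₂ d t₁ k i x * transversal t₂ d t₁ k i y)

  private
    pairCount≡ : ∀ t₂ d t₁ a p x b q y → x < m → y < m → pairCount t₂ d t₁ (a , p , x) (b , q , y) ≡
      δᵇ p (side t₂ d t₁ a) * δᵇ q (side t₂ d t₁ b) * K a b t₂ x y
    pairCount≡ t₂ d t₁ a p x b q y x<m y<m = begin
      ∑[ k ∈ upTo m ] ∑[ i ∈ upTo m ] (P * f k i * (Q * g k i))
        ≡⟨ ∑-cong (upTo m) (λ k → trans (∑-cong (upTo m) (λ i → rearrange P (f k i) Q (g k i)))
             (∑-*ˡ (P * Q) (upTo m) (λ i → f k i * g k i))) ⟩
      ∑[ k ∈ upTo m ] (P * Q * (∑[ i ∈ upTo m ] (f k i * g k i)))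
        ≡⟨ ∑-*ˡ (P * Q) (upTo m) _ ⟩
      P * Q * (∑[ k ∈ upTo m ] ∑[ i ∈ upTo m ] (f k i * g k i))
        ≡⟨ cong (P * Q *_) (∑-cong (upTo m) (λ k → count-two-translates (offset a t₂ k) (offset b t₂ k) x<m y<m)) ⟩
      P * Q * K a b t₂ x y ∎
      where
      open ≡-Reasoning
      P Q : ℕ
      P = δᵇ p (side t₂ d t₁ a)
      Q = δᵇ q (side t₂ d t₁ b)
      f g : ℕ → ℕ → ℕ
      f k i = δ ((i + offset a t₂ k) % m) x
      g k i = δ ((i + offset b t₂ k) % m) y
      rearrange : ∀ a b c d → a * b * (c * d) ≡ a * c * (b * d)
      rearrange = solve-∀

  private
    module _ {p q : Bool} {x y : ℕ} (x<m : x < m) (y<m : y < m) where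
      ∑pairCount≡ : ∀ a b → ∑[ t₂ ∈ bools ] ∑[ d ∈ bools ] ∑[ t₁ ∈ bools ] pairCount t₂ d t₁ (a , p , x) (b , q , y) ≡
        ∑[ t₂ ∈ bools ] (sides t₂ p q a b * K a b t₂ x y)
      ∑pairCount≡ a b = ∑-cong bools (λ t₂ → trans
        (∑-cong bools (λ d → trans
          (∑-cong bools (λ t₁ → pairCount≡ t₂ d t₁ a p x b q y x<m y<m))
          (∑-*ʳ (K a b t₂ x y) bools (λ t₁ → δᵇ p (side t₂ d t₁ a) * δᵇ q (side t₂ d t₁ b)))))
        (∑-*ʳ (K a b t₂ x y) bools (λ d → ∑[ t₁ ∈ bools ] (δᵇ p (side t₂ d t₁ a) * δᵇ q (side t₂ d t₁ b)))))

      pairCount-generic : Unit 3 → ∀ a₁ b₁ a₂ → ∑[ t₂ ∈ bools ] ∑[ d ∈ bools ] ∑[ t₁ ∈ bools ]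
        pairCount t₂ d t₁ ((a₁ , a₂) , p , x) ((b₁ , not a₂) , q , y) ≡ 2
      pairCount-generic u a₁ b₁ a₂ = trans (∑pairCount≡ (a₁ , a₂) (b₁ , not a₂)) (trans
        (∑-cong bools (λ t₂ → trans (cong (sides t₂ p q (a₁ , a₂) (b₁ , not a₂) *_) (K-generic u a₁ b₁ a₂ t₂ x y)) (*-identityʳ _)))
        (sides-generic p q a₁ b₁ a₂))

      pairCount-special : ∀ a₁ a₂ → ∑[ t₂ ∈ bools ] ∑[ d ∈ bools ] ∑[ t₁ ∈ bools ]
        pairCount t₂ d t₁ ((a₁ , a₂) , p , x) ((not a₁ , a₂) , q , y) ≡ 2
      pairCount-special a₁ a₂ = trans (∑pairCount≡ (a₁ , a₂) (not a₁ , a₂)) (trans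
        (∑-cong bools (λ t₂ → trans (cong (_* K (a₁ , a₂) (not a₁ , a₂) t₂ x y) (sides-special p q a₁ a₂ t₂)) (*-identityˡ _)))
        (K-special a₁ a₂ x y))

  pairCount-≢ : Unit 3 → ∀ a b {p q x y} → x < m → y < m → a ≢ b →
    ∑[ t₂ ∈ bools ] ∑[ d ∈ bools ] ∑[ t₁ ∈ bools ] pairCount t₂ d t₁ (a , p , x) (b , q , y) ≡ 2
  pairCount-≢ u (a₁    , false) (b₁    , true)  {p} {q} x<m y<m _  = pairCount-generic {p} {q} x<m y<m u a₁ b₁ false
  pairCount-≢ u (a₁    , true)  (b₁    , false) {p} {q} x<m y<m _  = pairCount-generic {p} {q} x<m y<m u a₁ b₁ true
  pairCount-≢ u (false , false) (true  , false) {p} {q} x<m y<m _  = pairCount-special {p} {q} x<m y<m false false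
  pairCount-≢ u (false , true)  (true  , true)  {p} {q} x<m y<m _  = pairCount-special {p} {q} x<m y<m false true
  pairCount-≢ u (true  , false) (false , false) {p} {q} x<m y<m _  = pairCount-special {p} {q} x<m y<m true false
  pairCount-≢ u (true  , true)  (false , true)  {p} {q} x<m y<m _  = pairCount-special {p} {q} x<m y<m true true
  pairCount-≢ u (false , false) (false , false) _   _   ne = ⊥-elim (ne refl)
  pairCount-≢ u (false , true)  (false , true)  _   _   ne = ⊥-elim (ne refl)
  pairCount-≢ u (true  , false) (true  , false) _   _   ne = ⊥-elim (ne refl)
  pairCount-≢ u (true  , true)  (true  , true)  _   _   ne = ⊥-elim (ne refl)

  δᵇ-exclusive : ∀ {p q} s → p ≢ q → δᵇ p s * δᵇ q s ≡ 0
  δᵇ-exclusive {false} {false} s     ne = ⊥-elim (ne refl)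
  δᵇ-exclusive {false} {true}  false ne = refl
  δᵇ-exclusive {false} {true}  true  ne = refl
  δᵇ-exclusive {true}  {false} false ne = refl
  δᵇ-exclusive {true}  {false} true  ne = refl
  δᵇ-exclusive {true}  {true}  s     ne = ⊥-elim (ne refl)

  -- A transversal has a single point in each class.
  pairCount-same : ∀ t₂ d t₁ {a z w} → z ≢ w → pairCount t₂ d t₁ (a , z) (a , w) ≡ 0
  pairCount-same t₂ d t₁ {a} {p , x} {q , y} z≢w =
    trans (∑-cong (upTo m) (λ k → trans (∑-cong (upTo m) (λ i → zer k i)) (∑-zero (upTo m)))) (∑-zero (upTo m))
    where
    s : Bool
    s = side t₂ d t₁ a
    rearrange : ∀ a b c d → a * b * (c * d) ≡ a * c * (b * d)
    rearrange = solve-∀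
    zer : ∀ k i → transversal t₂ d t₁ k i (a , p , x) * transversal t₂ d t₁ k i (a , q , y) ≡ 0
    zer k i with x ≟ y
    ... | yes refl = trans (rearrange (δᵇ p s) e (δᵇ q s) e)
                       (cong (_* (e * e)) (δᵇ-exclusive s (z≢w ∘ cong (_, x))))
      where
      e : ℕ
      e = δ ((i + offset a t₂ k) % m) x
    ... | no  x≢y  = trans (rearrange (δᵇ p s) _ (δᵇ q s) _)
                       (trans (cong (δᵇ p s * δᵇ q s *_) (δ-exclusive ((i + offset a t₂ k) % m) x≢y))
                              (*-zeroʳ (δᵇ p s * δᵇ q s)))

  -- The translates of a row cover once the points whose parity is the one chosen for their class,
  -- that is, half of all points.
  ∑-transversal : ∀ t₂ d t₁ k {a p x} → x < m →
    ∑[ i ∈ upTo m ] transversal t₂ d t₁ k i (a , p , x) ≡ δᵇ p (side t₂ d t₁ a)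
  ∑-transversal t₂ d t₁ k {a} {p} {x} x<m = trans (∑-*ˡ P (upTo m) _)
    (trans (cong (P *_) (count-translate (offset a t₂ k) x<m)) (*-identityʳ P))
    where
    P : ℕ
    P = δᵇ p (side t₂ d t₁ a)

-- The (quad, edge) pairs for one position of the quads

-- `concatMap` with the argument order of `∑`, so that a list of blocks and the sum over it have the
-- same shape.
collect : List X → (X → List Y) → List Y
collect xs g = concatMap g xs

∑-collect : ∀ (xs : List X) (g : X → List Y) {f : Y → ℕ} {k : X → ℕ} →
            (∀ x → ∑ (g x) f ≡ k x) → ∑ (collect xs g) f ≡ ∑ xs k
∑-collect xs g {f} e = trans (∑-concatMap g xs f) (∑-cong xs e)

-- A direction is a partition of the four classes into two pairs; κ selects the pair and o its member.
data Direction : Set where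
  I II III : Direction

ends : Direction → Bool → Bool → Class
ends I   κ o = κ , o
ends II  κ o = o , κ
ends III κ o = o , o xor κ

opaque
  directions : List Direction
  directions = I ∷ II ∷ III ∷ []

-- `a` is looked up in the pair `μ xor κ` and `b` in the pair `ν xor κ`: equal μ and ν mean the same
-- pair, different ones mean complementary pairs. `same` counts coinciding positions o, `opposite`
-- different ones.
same opposite : Bool → Bool → Class → Class → ℕ
same μ ν a b = ∑[ v ∈ directions ] ∑[ κ ∈ bools ]
  (δᶜ (ends v (μ xor κ) false) a * δᶜ (ends v (ν xor κ) false) b +
   δᶜ (ends v (μ xor κ) true)  a * δᶜ (ends v (ν xor κ) true)  b)
opposite μ ν a b = ∑[ v ∈ directions ] ∑[ κ ∈ bools ]
  (δᶜ (ends v (μ xor κ) false) a * δᶜ (ends v (ν xor κ) true)  b +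
   δᶜ (ends v (μ xor κ) true)  a * δᶜ (ends v (ν xor κ) false) b)

opaque
  unfolding bools directions

  -- A class lies in one pair of each of the three directions.
  same-≡ : ∀ μ a b → same μ μ a b ≡ 3 * δᶜ a b
  same-≡ μ (a , a′) (b , b′) = from-yes (∀Bool? λ μ → ∀Bool? λ a → ∀Bool? λ a′ → ∀Bool? λ b → ∀Bool? λ b′ →
    same μ μ (a , a′) (b , b′) ≟ 3 * δᶜ (a , a′) (b , b′)) μ a a′ b b′

  -- Two distinct classes form a pair in exactly one direction.
  opposite-≡ : ∀ μ a b → opposite μ μ a b + δᶜ a b ≡ 1
  opposite-≡ μ (a , a′) (b , b′) = from-yes (∀Bool? λ μ → ∀Bool? λ a → ∀Bool? λ a′ → ∀Bool? λ b → ∀Bool? λ b′ →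
    opposite μ μ (a , a′) (b , b′) + δᶜ (a , a′) (b , b′) ≟ 1) μ a a′ b b′

  -- Edges between the classes of a quad's own pair in one half, between the complementary classes in the other.
  balance : ∀ a b → (same false false a b + opposite false false a b) + (same false true b a + opposite false true b a) ≡ 3
  balance (a , a′) (b , b′) = from-yes (∀Bool? λ a → ∀Bool? λ a′ → ∀Bool? λ b → ∀Bool? λ b′ →
    (same false false (a , a′) (b , b′) + opposite false false (a , a′) (b , b′)) +
    (same false true (b , b′) (a , a′) + opposite false true (b , b′) (a , a′)) ≟ 3) a a′ b b′

  -- In each of the three directions `b` lies in one edge pair, and the quad pair that goes with it
  -- has two classes.
  ∑-directions-≡6 : ∀ μ b → ∑[ a₁ ∈ bools ] ∑[ a₂ ∈ bools ] (same false μ (a₁ , a₂) b + opposite false μ (a₁ , a₂) b) ≡ 6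
  ∑-directions-≡6 μ (b , b′) = from-yes (∀Bool? λ μ → ∀Bool? λ b → ∀Bool? λ b′ →
    ∑[ a₁ ∈ bools ] ∑[ a₂ ∈ bools ] (same false μ (a₁ , a₂) (b , b′) + opposite false μ (a₁ , a₂) (b , b′)) ≟ 6) μ b b′

  ∑-directions-≡6′ : ∀ μ a → ∑[ b₁ ∈ bools ] ∑[ b₂ ∈ bools ] (same false μ a (b₁ , b₂) + opposite false μ a (b₁ , b₂)) ≡ 6
  ∑-directions-≡6′ μ (a , a′) = from-yes (∀Bool? λ μ → ∀Bool? λ a → ∀Bool? λ a′ →
    ∑[ b₁ ∈ bools ] ∑[ b₂ ∈ bools ] (same false μ (a , a′) (b₁ , b₂) + opposite false μ (a , a′) (b₁ , b₂)) ≟ 6) μ a a′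

δᶜ-refl : ∀ a → δᶜ a a ≡ 1
δᶜ-refl (false , false) = refl
δᶜ-refl (false , true)  = refl
δᶜ-refl (true  , false) = refl
δᶜ-refl (true  , true)  = refl

δᶜ-≢ : ∀ a b → a ≢ b → δᶜ a b ≡ 0
δᶜ-≢ (false , a)     (true  , b)     ne = refl
δᶜ-≢ (true  , a)     (false , b)     ne = refl
δᶜ-≢ (false , false) (false , true)  ne = refl
δᶜ-≢ (false , true)  (false , false) ne = refl
δᶜ-≢ (true  , false) (true  , true)  ne = refl
δᶜ-≢ (true  , true)  (true  , false) ne = refl
δᶜ-≢ (false , false) (false , false) ne = ⊥-elim (ne refl)
δᶜ-≢ (false , true)  (false , true)  ne = ⊥-elim (ne refl)
δᶜ-≢ (true  , false) (true  , false) ne = ⊥-elim (ne refl)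
δᶜ-≢ (true  , true)  (true  , true)  ne = ⊥-elim (ne refl)

-- For weights spread over two classes: the coefficients indicate the classes of two points, so the
-- counts split into a part `S` for corresponding classes and a part `O` for the other combinations.
∑-bilinear : ∀ (Θ : List X) (α β α′ β′ : X → ℕ) {S O} →
  ∑[ θ ∈ Θ ] (α θ * α′ θ) ≡ S → ∑[ θ ∈ Θ ] (β θ * β′ θ) ≡ S →
  ∑[ θ ∈ Θ ] (α θ * β′ θ) ≡ O → ∑[ θ ∈ Θ ] (β θ * α′ θ) ≡ O →
  ∀ a b a′ b′ → ∑[ θ ∈ Θ ] ((a * α θ + b * β θ) * (a′ * α′ θ + b′ * β′ θ)) ≡
                (a * a′ + b * b′) * S + (a * b′ + b * a′) * O
∑-bilinear Θ α β α′ β′ {S} {O} eS eS′ eO eO′ a b a′ b′ = begin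
  ∑[ θ ∈ Θ ] ((a * α θ + b * β θ) * (a′ * α′ θ + b′ * β′ θ))
    ≡⟨ ∑-cong Θ (λ θ → expand a (α θ) b (β θ) a′ (α′ θ) b′ (β′ θ)) ⟩
  ∑[ θ ∈ Θ ] ((a * a′ * (α θ * α′ θ) + b * b′ * (β θ * β′ θ)) + (a * b′ * (α θ * β′ θ) + b * a′ * (β θ * α′ θ)))
    ≡⟨ ∑-+ Θ _ _ ⟩
  ∑[ θ ∈ Θ ] (a * a′ * (α θ * α′ θ) + b * b′ * (β θ * β′ θ)) + ∑[ θ ∈ Θ ] (a * b′ * (α θ * β′ θ) + b * a′ * (β θ * α′ θ))
    ≡⟨ cong₂ _+_ (two (a * a′) (b * b′) (λ θ → α θ * α′ θ) (λ θ → β θ * β′ θ) eS eS′)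
                 (two (a * b′) (b * a′) (λ θ → α θ * β′ θ) (λ θ → β θ * α′ θ) eO eO′) ⟩
  (a * a′ + b * b′) * S + (a * b′ + b * a′) * O ∎
  where
  open ≡-Reasoning
  expand : ∀ a α b β a′ α′ b′ β′ → (a * α + b * β) * (a′ * α′ + b′ * β′) ≡
    (a * a′ * (α * α′) + b * b′ * (β * β′)) + (a * b′ * (α * β′) + b * a′ * (β * α′))
  expand = solve-∀
  two : ∀ c d f g {T} → ∑ Θ f ≡ T → ∑ Θ g ≡ T → ∑[ θ ∈ Θ ] (c * f θ + d * g θ) ≡ (c + d) * T
  two c d f g {T} ef eg = trans (∑-+ Θ (λ θ → c * f θ) (λ θ → d * g θ))
    (trans (cong₂ _+_ (trans (∑-*ˡ c Θ f) (cong (c *_) ef)) (trans (∑-*ˡ d Θ g) (cong (d *_) eg)))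
           (sym (*-distribʳ-+ T c d)))

module HalfDesign (h m v : ℕ) .{{_ : NonZero m}} .{{_ : NonZero v}}
                  (m≡ : m ≡ suc h) (v≡ : v ≡ suc (2 * h)) where
  open OneFactorization h m v m≡ v≡
  open Transversals m
  open Modular m using (∑-shift; Unit)

  -- A subset of one group as its indicator function, so that incidences are sums of products. That
  -- the values are 0 and 1 is the business of `Proper`.
  Weight : Set
  Weight = Point → ℕ

  -- Turns the coordinates used by transversals, a parity and a residue modulo m, into a vertex of
  -- K_{2m} as numbered by the 1-factorization.
  flat : Bool → ℕ → ℕ
  flat false x = x
  flat true  x = m + x

  2m≡ : m + m ≡ suc v
  2m≡ = trans (cong₂ _+_ m≡ m≡) (trans (lemma h) (cong suc (sym v≡)))
    where
    lemma : ∀ h → suc h + suc h ≡ suc (suc (2 * h))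
    lemma = solve-∀

  flat-< : ∀ p {x} → x < m → flat p x < suc v
  flat-< p {x} x<m = subst (flat p x <_) 2m≡ (go p)
    where
    go : ∀ p → flat p x < m + m
    go false = ≤-trans x<m (m≤m+n m m)
    go true  = +-monoʳ-< m x<m

  flat-injective : ∀ {p q x y} → x < m → y < m → flat p x ≡ flat q y → (p , x) ≡ (q , y)
  flat-injective {false} {false} _   _   refl = refl
  flat-injective {true}  {true}  _   _   e    = cong (true ,_) (+-cancelˡ-≡ m _ _ e)
  flat-injective {false} {true}  x<m _   refl = ⊥-elim (<⇒≱ x<m (m≤m+n m _))
  flat-injective {true}  {false} _   y<m refl = ⊥-elim (<⇒≱ y<m (m≤m+n m _))

  doublePair : Class → Class → ℕ → ℕ → ℕ → Weight
  doublePair a b j q r (c , p , x) = δᶜ a c * on j q (flat p x) + δᶜ b c * on j r (flat p x)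

  -- An edge of K_{2m} with one end moved to each class, `τ` choosing which. These are the edges
  -- between the classes that do not join equal vertices; the others are the rungs.
  crossEdge : Class → Class → ℕ → ℕ → Bool → Weight
  crossEdge a b j q τ (c , p , x) = δᶜ a c * δ (E j q τ) (flat p x) + δᶜ b c * δ (E j q (not τ)) (flat p x)

  innerEdge : Class → ℕ → ℕ → Weight
  innerEdge a j q (c , p , x) = δᶜ a c * on j q (flat p x)

  rung : Direction → Bool → Bool → ℕ → Weight
  rung d κ s w (c , p , x) = (δᶜ (ends d κ false) c + δᶜ (ends d κ true) c) * (δᵇ s p * δ w x)

  -- In each class, a direction-I rung is coupled with the edge of the last factor at the same point, and a
  -- direction-II rung with the direction-III rung: same t, opposite d.  Every (t₂ , d , t₁) is used equally often.
  rungType : Direction → Bool → Bool → Bool × Bool × Bool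
  rungType I   κ s = κ , true  , false
  rungType II  κ s = s , false , true
  rungType III κ s = s , true  , true

  params : List (ℕ × ℕ × Bool × ℕ)
  params = collect (upTo v) λ j → collect (upTo m) λ q → collect bools λ τ → map (λ i → j , q , τ , i) (upTo m)

  transversals : Bool × Bool × Bool → ℕ → Weight → List (Weight × Weight)
  transversals (t₂ , d , t₁) k e = map (λ i → transversal t₂ d t₁ k i , e) (upTo m)

  -- For fixed `j`, `q`, `τ` the quads indexed by `i` cover both classes once and share one edge.
  -- Here `q` is both the cyclic shift matching the two copies of the factor and the number of the
  -- shared edge; `μ` moves that edge to the complementary classes.
  pairBlocks : Bool → List (Weight × Weight)
  pairBlocks μ = collect directions λ d → collect bools λ κ →
    map (λ (j , q , τ , i) → doublePair (ends d κ false) (ends d κ true) j i ((i + q) % m) ,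
                             crossEdge (ends d (μ xor κ) false) (ends d (μ xor κ) true) j q τ) params

  -- Within a class the factors 2g and 2g + 1 are coupled: `d` tells them apart and gives them
  -- complementary halves. The number of factors is odd, so the factor 2h is left over and is
  -- coupled with rungs.
  innerBlocks lastBlocks rungBlocks : List (Weight × Weight)
  innerBlocks = collect (upTo h) λ g → collect bools λ t₂ → collect bools λ d → collect bools λ t₁ → collect (upTo m) λ q →
    transversals (t₂ , d , t₁) q (innerEdge (t₁ , t₂) (bit d + 2 * g) q)
  lastBlocks = collect bools λ t₁ → collect bools λ t₂ → collect (upTo m) λ q →
    transversals (t₁ , false , false) q (innerEdge (t₁ , t₂) (2 * h) q)
  rungBlocks = collect directions λ d → collect bools λ κ → collect bools λ s → collect (upTo m) λ w →
    transversals (rungType d κ s) w (rung d κ s w)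

  half : Bool → List (Weight × Weight)
  half μ = pairBlocks μ ++ innerBlocks ++ lastBlocks ++ rungBlocks

  ∑-params : ∀ f → ∑ params f ≡ ∑[ j ∈ upTo v ] ∑[ q ∈ upTo m ] ∑[ τ ∈ bools ] ∑[ i ∈ upTo m ] f (j , q , τ , i)
  ∑-params f = ∑-collect (upTo v) _ λ j → ∑-collect (upTo m) _ λ q → ∑-collect bools _ λ τ → ∑-map _ (upTo m) f

  module _ (f : Weight × Weight → ℕ) where
    ∑-pairBlocks : ∀ μ → ∑ (pairBlocks μ) f ≡ ∑[ d ∈ directions ] ∑[ κ ∈ bools ] ∑ params λ (j , q , τ , i) →
      f (doublePair (ends d κ false) (ends d κ true) j i ((i + q) % m) ,
         crossEdge (ends d (μ xor κ) false) (ends d (μ xor κ) true) j q τ)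
    ∑-pairBlocks μ = ∑-collect directions _ λ d → ∑-collect bools _ λ κ → ∑-map _ params f

    ∑-transversals : Bool × Bool × Bool → ℕ → Weight → ℕ
    ∑-transversals (t₂ , d , t₁) k e = ∑[ i ∈ upTo m ] f (transversal t₂ d t₁ k i , e)

    ∑-innerBlocks : ∑ innerBlocks f ≡ ∑[ g ∈ upTo h ] ∑[ t₂ ∈ bools ] ∑[ d ∈ bools ] ∑[ t₁ ∈ bools ] ∑[ q ∈ upTo m ]
      ∑-transversals (t₂ , d , t₁) q (innerEdge (t₁ , t₂) (bit d + 2 * g) q)
    ∑-innerBlocks = ∑-collect (upTo h) _ λ g → ∑-collect bools _ λ t₂ → ∑-collect bools _ λ d → ∑-collect bools _ λ t₁ →
      ∑-collect (upTo m) _ λ q → ∑-map _ (upTo m) f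

    ∑-lastBlocks : ∑ lastBlocks f ≡ ∑[ t₁ ∈ bools ] ∑[ t₂ ∈ bools ] ∑[ q ∈ upTo m ]
      ∑-transversals (t₁ , false , false) q (innerEdge (t₁ , t₂) (2 * h) q)
    ∑-lastBlocks = ∑-collect bools _ λ t₁ → ∑-collect bools _ λ t₂ → ∑-collect (upTo m) _ λ q → ∑-map _ (upTo m) f

    ∑-rungBlocks : ∑ rungBlocks f ≡ ∑[ d ∈ directions ] ∑[ κ ∈ bools ] ∑[ s ∈ bools ] ∑[ w ∈ upTo m ]
      ∑-transversals (rungType d κ s) w (rung d κ s w)
    ∑-rungBlocks = ∑-collect directions _ λ d → ∑-collect bools _ λ κ → ∑-collect bools _ λ s →
      ∑-collect (upTo m) _ λ w → ∑-map _ (upTo m) f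

    ∑-half : ∀ μ → ∑ (half μ) f ≡ ∑ (pairBlocks μ) f + (∑ innerBlocks f + (∑ lastBlocks f + ∑ rungBlocks f))
    ∑-half μ = trans (∑-++ (pairBlocks μ) _ f) (cong (∑ (pairBlocks μ) f +_)
      (trans (∑-++ innerBlocks _ f) (cong (∑ innerBlocks f +_) (∑-++ lastBlocks rungBlocks f))))

  private
    classTotals : ∀ μ ν (k : Direction → Bool → ℕ) a b S O →
      (∀ d κ → k d κ ≡
        (δᶜ (ends d (μ xor κ) false) a * δᶜ (ends d (ν xor κ) false) b + δᶜ (ends d (μ xor κ) true) a * δᶜ (ends d (ν xor κ) true) b) * S +
        (δᶜ (ends d (μ xor κ) false) a * δᶜ (ends d (ν xor κ) true) b + δᶜ (ends d (μ xor κ) true) a * δᶜ (ends d (ν xor κ) false) b) * O) →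
      ∑[ d ∈ directions ] ∑[ κ ∈ bools ] k d κ ≡ same μ ν a b * S + opposite μ ν a b * O
    classTotals μ ν k a b S O e = begin
      ∑[ d ∈ directions ] ∑[ κ ∈ bools ] k d κ
        ≡⟨ ∑-cong directions (λ d → trans (∑-cong bools (e d)) (∑-+ bools (λ κ → s d κ * S) (λ κ → o d κ * O))) ⟩
      ∑[ d ∈ directions ] ((∑[ κ ∈ bools ] (s d κ * S)) + (∑[ κ ∈ bools ] (o d κ * O)))
        ≡⟨ ∑-+ directions _ _ ⟩
      ∑[ d ∈ directions ] ∑[ κ ∈ bools ] (s d κ * S) + ∑[ d ∈ directions ] ∑[ κ ∈ bools ] (o d κ * O)
        ≡⟨ cong₂ _+_ (factor s S) (factor o O) ⟩
      same μ ν a b * S + opposite μ ν a b * O ∎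
      where
      open ≡-Reasoning
      s o : Direction → Bool → ℕ
      s d κ = δᶜ (ends d (μ xor κ) false) a * δᶜ (ends d (ν xor κ) false) b + δᶜ (ends d (μ xor κ) true) a * δᶜ (ends d (ν xor κ) true) b
      o d κ = δᶜ (ends d (μ xor κ) false) a * δᶜ (ends d (ν xor κ) true) b + δᶜ (ends d (μ xor κ) true) a * δᶜ (ends d (ν xor κ) false) b
      factor : ∀ (f : Direction → Bool → ℕ) T → ∑[ d ∈ directions ] ∑[ κ ∈ bools ] (f d κ * T) ≡ (∑[ d ∈ directions ] ∑[ κ ∈ bools ] f d κ) * T
      factor f T = trans (∑-cong directions (λ d → ∑-*ʳ T bools (f d))) (∑-*ʳ T directions (λ d → ∑ bools (f d)))

    -- For equal classes only the `S` term survives, with coefficient 3; for different ones only the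
    -- `O` term, with coefficient 1.
    same+opposite : ∀ μ a b {S O T} → (a ≡ b → 3 * S ≡ T) → (a ≢ b → O ≡ T) → same μ μ a b * S + opposite μ μ a b * O ≡ T
    same+opposite μ a b {S} {O} {T} eq ne with ≡-dec Data.Bool._≟_ Data.Bool._≟_ a b
      where open import Data.Bool
    ... | yes refl = begin
      same μ μ a a * S + opposite μ μ a a * O
        ≡⟨ cong₂ (λ k l → k * S + l * O) (trans (same-≡ μ a a) (cong (3 *_) (δᶜ-refl a)))
             (+-cancelʳ-≡ 1 _ 0 (trans (cong (opposite μ μ a a +_) (sym (δᶜ-refl a))) (opposite-≡ μ a a))) ⟩
      3 * S + 0
        ≡⟨ +-identityʳ _ ⟩
      3 * S
        ≡⟨ eq refl ⟩
      T ∎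
      where open ≡-Reasoning
    ... | no a≢b = begin
      same μ μ a b * S + opposite μ μ a b * O
        ≡⟨ cong₂ (λ k l → k * S + l * O) (trans (same-≡ μ a b) (cong (3 *_) (δᶜ-≢ a b a≢b)))
             (trans (sym (+-identityʳ _)) (trans (cong (opposite μ μ a b +_) (sym (δᶜ-≢ a b a≢b))) (opposite-≡ μ a b))) ⟩
      1 * O
        ≡⟨ *-identityˡ O ⟩
      O
        ≡⟨ ne a≢b ⟩
      T ∎
      where open ≡-Reasoning

  ∑-bools-const : ∀ k → ∑[ b ∈ bools ] k ≡ 2 * k
  ∑-bools-const k = trans (∑-bools (λ _ → k)) (cong (k +_) (sym (+-identityʳ k)))

  ∑-bools-not : ∀ (f : Bool → ℕ) → ∑[ τ ∈ bools ] f (not τ) ≡ ∑ bools f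
  ∑-bools-not f = trans (∑-bools (λ τ → f (not τ))) (trans (+-comm (f true) (f false)) (sym (∑-bools f)))

  -- Counts for blocks on pairs of classes

  private
    ∑-params-cong : ∀ f g → (∀ j q → ∑[ τ ∈ bools ] ∑[ i ∈ upTo m ] f (j , q , τ , i) ≡ ∑[ τ ∈ bools ] ∑[ i ∈ upTo m ] g (j , q , τ , i)) →
                    ∑ params f ≡ ∑ params g
    ∑-params-cong f g e = trans (∑-params f)
      (trans (∑-cong (upTo v) (λ j → ∑-cong (upTo m) (e j))) (sym (∑-params g)))

    module QuadSums {x y : ℕ} (x< : x < suc v) (y< : y < suc v) where
      aligned shifted crossed : ℕ
      aligned   = ∑ params λ (j , q , τ , i) → on j i x * on j i y
      shifted = ∑ params λ (j , q , τ , i) → on j ((i + q) % m) x * on j ((i + q) % m) y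
      crossed = ∑ params λ (j , q , τ , i) → on j i x * on j ((i + q) % m) y

      shifted≡aligned : shifted ≡ aligned
      shifted≡aligned = ∑-params-cong _ _ λ j q → ∑-cong bools λ τ → ∑-shift q (λ i → on j i x * on j i y)

      -- Two vertices have one common edge in the whole factorization; it is repeated for m shifts
      -- `q` and two values of `τ`.
      aligned≡ : x ≢ y → aligned ≡ 2 * m
      aligned≡ x≢y = begin
        aligned
          ≡⟨ ∑-params _ ⟩
        ∑[ j ∈ upTo v ] ∑[ q ∈ upTo m ] ∑[ τ ∈ bools ] ∑[ i ∈ upTo m ] (on j i x * on j i y)
          ≡⟨ ∑-cong (upTo v) (λ j → trans (∑-cong (upTo m) (λ q → trans
               (∑-cong bools (λ τ → ∑-cong (upTo m) (λ i → on*on≡joins j i x≢y)))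
               (∑-bools-const (T j)))) (∑-const m (2 * T j))) ⟩
        ∑[ j ∈ upTo v ] (m * (2 * T j))
          ≡⟨ trans (∑-*ˡ m (upTo v) _) (cong (m *_) (∑-*ˡ 2 (upTo v) T)) ⟩
        m * (2 * ∑ (upTo v) T)
          ≡⟨ cong (λ k → m * (2 * k)) (count-joins x y x< y< x≢y) ⟩
        m * 2
          ≡⟨ *-comm m 2 ⟩
        2 * m ∎
        where
        open ≡-Reasoning
        T : ℕ → ℕ
        T j = ∑[ i ∈ upTo m ] joins j i x y

      -- In a fixed factor `x` determines the edge `i`, and then `y` determines the shift `q`. The v
      -- factors and the two values of `τ` remain.
      crossed≡ : crossed ≡ 2 * v
      crossed≡ = begin
        crossed
          ≡⟨ ∑-params _ ⟩
        ∑[ j ∈ upTo v ] ∑[ q ∈ upTo m ] ∑[ τ ∈ bools ] ∑[ i ∈ upTo m ] (on j i x * on j ((i + q) % m) y)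
          ≡⟨ ∑-cong (upTo v) inner ⟩
        ∑[ j ∈ upTo v ] 2
          ≡⟨ ∑-const v 2 ⟩
        v * 2
          ≡⟨ *-comm v 2 ⟩
        2 * v ∎
        where
        open ≡-Reasoning
        inner : ∀ j → ∑[ q ∈ upTo m ] ∑[ τ ∈ bools ] ∑[ i ∈ upTo m ] (on j i x * on j ((i + q) % m) y) ≡ 2
        inner j = begin
          ∑[ q ∈ upTo m ] ∑[ τ ∈ bools ] ∑[ i ∈ upTo m ] (on j i x * on j ((i + q) % m) y)
            ≡⟨ ∑-swap (upTo m) bools _ ⟩
          ∑[ τ ∈ bools ] ∑[ q ∈ upTo m ] ∑[ i ∈ upTo m ] (on j i x * on j ((i + q) % m) y)
            ≡⟨ ∑-cong bools (λ τ → begin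
                 ∑[ q ∈ upTo m ] ∑[ i ∈ upTo m ] (on j i x * on j ((i + q) % m) y)
                   ≡⟨ ∑-swap (upTo m) (upTo m) _ ⟩
                 ∑[ i ∈ upTo m ] ∑[ q ∈ upTo m ] (on j i x * on j ((i + q) % m) y)
                   ≡⟨ ∑-cong (upTo m) (λ i → trans (∑-*ˡ (on j i x) (upTo m) _) (trans
                        (cong (on j i x *_) (trans
                          (∑-cong (upTo m) (λ q → cong (λ k → on j (k % m) y) (+-comm i q)))
                          (trans (∑-shift i (λ q → on j q y)) (count-on j y y<))))
                        (*-identityʳ (on j i x)))) ⟩
                 ∑[ i ∈ upTo m ] on j i x
                   ≡⟨ count-on j x x< ⟩
                 1 ∎) ⟩
          ∑[ τ ∈ bools ] 1
            ≡⟨ ∑-bools-const 1 ⟩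
          2 ∎

    module EdgeSums {x y : ℕ} (x< : x < suc v) (y< : y < suc v) where
      aligned flipped crossed crossed′ : ℕ
      aligned    = ∑ params λ (j , q , τ , i) → δ (E j q τ) x * δ (E j q τ) y
      flipped  = ∑ params λ (j , q , τ , i) → δ (E j q (not τ)) x * δ (E j q (not τ)) y
      crossed  = ∑ params λ (j , q , τ , i) → δ (E j q τ) x * δ (E j q (not τ)) y
      crossed′ = ∑ params λ (j , q , τ , i) → δ (E j q (not τ)) x * δ (E j q τ) y

      flipped≡aligned : flipped ≡ aligned
      flipped≡aligned = ∑-params-cong _ _ λ j q → ∑-bools-not (λ τ → ∑[ i ∈ upTo m ] (δ (E j q τ) x * δ (E j q τ) y))

      crossed′≡crossed : crossed′ ≡ crossed
      crossed′≡crossed = ∑-params-cong _ _ λ j q → trans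
        (sym (∑-bools-not (λ τ → ∑[ i ∈ upTo m ] (δ (E j q (not τ)) x * δ (E j q τ) y))))
        (∑-cong bools (λ { false → refl ; true → refl }))

      aligned≡ : x ≢ y → aligned ≡ 0
      aligned≡ x≢y = trans (∑-cong params (λ (j , q , τ , i) → δ-exclusive (E j q τ) x≢y)) (∑-zero params)

      crossed≡∑joins : crossed ≡ m * (∑[ j ∈ upTo v ] ∑[ q ∈ upTo m ] joins j q x y)
      crossed≡∑joins = begin
        crossed
          ≡⟨ ∑-params _ ⟩
        ∑[ j ∈ upTo v ] ∑[ q ∈ upTo m ] ∑[ τ ∈ bools ] ∑[ i ∈ upTo m ] (δ (E j q τ) x * δ (E j q (not τ)) y)
          ≡⟨ ∑-cong (upTo v) (λ j → trans (∑-cong (upTo m) (λ q → trans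
               (∑-cong bools (λ τ → ∑-const m (δ (E j q τ) x * δ (E j q (not τ)) y)))
               (trans (∑-*ˡ m bools _) (cong (m *_) (∑-bools (λ τ → δ (E j q τ) x * δ (E j q (not τ)) y))))))
               (∑-*ˡ m (upTo m) _)) ⟩
        ∑[ j ∈ upTo v ] (m * (∑[ q ∈ upTo m ] joins j q x y))
          ≡⟨ ∑-*ˡ m (upTo v) _ ⟩
        m * (∑[ j ∈ upTo v ] ∑[ q ∈ upTo m ] joins j q x y) ∎
        where open ≡-Reasoning

      -- Each edge is repeated m times, once for every `i`. The term missing for equal vertices is
      -- kept on the left, as the rungs will supply it.
      crossed≡ : crossed + m * δ x y ≡ m
      crossed≡ with x ≟ y
      ... | no x≢y = trans (cong₂ _+_ (trans crossed≡∑joins (cong (m *_) (count-joins x y x< y< x≢y))) (cong (m *_) (δ-≢ x≢y))) (lemma m)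
        where
        lemma : ∀ m → m * 1 + m * 0 ≡ m
        lemma = solve-∀
      ... | yes refl = trans (cong₂ _+_ (trans crossed≡∑joins (cong (m *_) zeros)) (cong (m *_) (δ-≡ {x} refl))) (lemma m)
        where
        lemma : ∀ m → m * 0 + m * 1 ≡ m
        lemma = solve-∀
        zeros : ∑[ j ∈ upTo v ] ∑[ q ∈ upTo m ] joins j q x x ≡ 0
        zeros = trans (∑-cong (upTo v) (λ j → trans (∑-cong-< m (λ q q<m → joins-self j q x q<m x<)) (∑-zero (upTo m)))) (∑-zero (upTo v))

    module CrossSums {x y : ℕ} (x< : x < suc v) (y< : y < suc v) where
      -- The quads sharing an edge cover `x` once, and the edges of one factor meet `y` once; the v
      -- factors remain. `c` and `e` select which of the two classes is meant for the quad and for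
      -- the edge.
      ∑-on-E : ∀ (c : ℕ → ℕ → ℕ) (e : Bool → Bool) →
        (∀ j q → ∑[ i ∈ upTo m ] on j (c q i) x ≡ 1) →
        (∀ j q → ∑[ τ ∈ bools ] δ (E j q (e τ)) y ≡ on j q y) →
        ∑ params (λ (j , q , τ , i) → on j (c q i) x * δ (E j q (e τ)) y) ≡ v
      ∑-on-E c e ec ee = begin
        ∑ params (λ (j , q , τ , i) → on j (c q i) x * δ (E j q (e τ)) y)
          ≡⟨ ∑-params _ ⟩
        ∑[ j ∈ upTo v ] ∑[ q ∈ upTo m ] ∑[ τ ∈ bools ] ∑[ i ∈ upTo m ] (on j (c q i) x * δ (E j q (e τ)) y)
          ≡⟨ ∑-cong (upTo v) (λ j → trans (∑-cong (upTo m) (λ q → trans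
               (∑-cong bools (λ τ → trans (∑-*ʳ (δ (E j q (e τ)) y) (upTo m) _)
                 (trans (cong (_* δ (E j q (e τ)) y) (ec j q)) (*-identityˡ _)))) (ee j q)))
               (count-on j y y<)) ⟩
        ∑[ j ∈ upTo v ] 1
          ≡⟨ trans (∑-const v 1) (*-identityʳ v) ⟩
        v ∎
        where open ≡-Reasoning

      plain : ∀ j (q : ℕ) → ∑[ i ∈ upTo m ] on j i x ≡ 1
      plain j q = count-on j x x<

      shifted : ∀ j q → ∑[ i ∈ upTo m ] on j ((i + q) % m) x ≡ 1
      shifted j q = trans (∑-shift q (λ i → on j i x)) (count-on j x x<)

      straight : ∀ j q → ∑[ τ ∈ bools ] δ (E j q τ) y ≡ on j q y
      straight j q = ∑-bools (λ τ → δ (E j q τ) y)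

      flipped : ∀ j q → ∑[ τ ∈ bools ] δ (E j q (not τ)) y ≡ on j q y
      flipped j q = trans (∑-bools-not (λ τ → δ (E j q τ) y)) (straight j q)

  -- Pairs of points in the quads

  private
    pairBlocks-quads : ∀ μ a p x b q y {T} → x < m → y < m → (a , p , x) ≢ (b , q , y) →
      (a ≡ b → 6 * m ≡ T) → (a ≢ b → 2 * v ≡ T) →
      ∑ (pairBlocks μ) (λ B → proj₁ B (a , p , x) * proj₁ B (b , q , y)) ≡ T
    pairBlocks-quads μ a p x b q y x<m y<m x≢y eq ne = trans (∑-pairBlocks _ μ) (trans
        (classTotals false false _ a b S.aligned S.crossed (λ d κ →
          ∑-bilinear params _ _ _ _ refl S.shifted≡aligned refl
            -- This sum is `crossed` with the two points exchanged; both equal 2v.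
            (trans (∑-cong params (λ (j , q′ , τ , i) → *-comm (on j ((i + q′) % m) (flat p x)) (on j i (flat q y))))
                   (trans S′.crossed≡ (sym S.crossed≡)))
            (δᶜ (ends d κ false) a) (δᶜ (ends d κ true) a) (δᶜ (ends d κ false) b) (δᶜ (ends d κ true) b)))
        (same+opposite false a b
          (λ { refl → trans (cong (3 *_) (S.aligned≡ (λ e → x≢y (cong (a ,_) (flat-injective x<m y<m e)))))
                        (trans (sym (*-assoc 3 2 m)) (eq refl)) })
          (λ a≢b → trans S.crossed≡ (ne a≢b))))
      where
      module S = QuadSums (flat-< p x<m) (flat-< q y<m)
      module S′ = QuadSums (flat-< q y<m) (flat-< p x<m)

    opaque
      unfolding bools directions

      -- The last factor and the rungs together use every type (t₂, d, t₁) twice. With the h uses in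
      -- `innerBlocks` this makes h + 2.
      regroup : ∀ (W : Bool → Bool → Bool → ℕ) →
        ∑[ t₁ ∈ bools ] ∑[ t₂ ∈ bools ] W t₁ false false +
        ∑[ d ∈ directions ] ∑[ κ ∈ bools ] ∑[ s ∈ bools ] (let t₂ , e , t₁ = rungType d κ s in W t₂ e t₁) ≡
        2 * (∑[ t₂ ∈ bools ] ∑[ d ∈ bools ] ∑[ t₁ ∈ bools ] W t₂ d t₁)
      regroup W = lemma (W false false false) (W false false true) (W false true false) (W false true true)
                        (W true false false) (W true false true) (W true true false) (W true true true)
        where
        lemma : ∀ a b c d e f g k →
          a + (a + 0) + (e + (e + 0) + 0) +
          (c + (c + 0) + (g + (g + 0) + 0) + (b + (f + 0) + (b + (f + 0) + 0) + (d + (k + 0) + (d + (k + 0) + 0) + 0))) ≡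
          2 * (a + (b + 0) + (c + (d + 0) + 0) + (e + (f + 0) + (g + (k + 0) + 0) + 0))
        lemma = solve-∀

  -- Within a class only `pairBlocks` contribute. Between classes they give 2v and the transversals
  -- 2(h + 2), where 2(2h + 1) + 2(h + 2) = 6(h + 1).
  half-quads : Unit 3 → ∀ μ {a p x b q y} → x < m → y < m → (a , p , x) ≢ (b , q , y) →
    ∑ (half μ) (λ B → proj₁ B (a , p , x) * proj₁ B (b , q , y)) ≡ 6 * m
  half-quads unit-3 μ {a} {p} {x} {b} {q} {y} x<m y<m x≢y = trans (∑-half f μ) (begin
    ∑ (pairBlocks μ) f + (∑ innerBlocks f + (∑ lastBlocks f + ∑ rungBlocks f))
      ≡⟨ cong (∑ (pairBlocks μ) f +_) (cong₂ _+_
           (trans (∑-innerBlocks f) (∑-const h total))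
           (trans (cong₂ _+_ (∑-lastBlocks f) (∑-rungBlocks f)) (regroup W))) ⟩
    ∑ (pairBlocks μ) f + (h * total + 2 * total)
      ≡⟨ finish (≡-dec Data.Bool._≟_ Data.Bool._≟_ a b) ⟩
    6 * m ∎)
    where
    open ≡-Reasoning
    f : Weight × Weight → ℕ
    f B = proj₁ B (a , p , x) * proj₁ B (b , q , y)
    W : Bool → Bool → Bool → ℕ
    W t₂ d t₁ = pairCount t₂ d t₁ (a , p , x) (b , q , y)
    total : ℕ
    total = ∑[ t₂ ∈ bools ] ∑[ d ∈ bools ] ∑[ t₁ ∈ bools ] W t₂ d t₁
    finish : Dec (a ≡ b) → ∑ (pairBlocks μ) f + (h * total + 2 * total) ≡ 6 * m
    finish (yes refl) = trans (cong₂ (λ k l → k + (h * l + 2 * l))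
        (pairBlocks-quads μ a p x b q y x<m y<m x≢y (λ _ → refl) (λ a≢a → ⊥-elim (a≢a refl))) zeros) (lemma h m)
      where
      zeros : total ≡ 0
      zeros = trans (∑-cong bools (λ t₂ → trans (∑-cong bools (λ d → trans
        (∑-cong bools (λ t₁ → pairCount-same t₂ d t₁ {a} {p , x} {q , y} (λ e → x≢y (cong (a ,_) e))))
        (∑-zero bools))) (∑-zero bools))) (∑-zero bools)
      lemma : ∀ h m → 6 * m + (h * 0 + 2 * 0) ≡ 6 * m
      lemma = solve-∀
    finish (no a≢b) = trans (cong₂ (λ k l → k + (h * l + 2 * l))
        (pairBlocks-quads μ a p x b q y x<m y<m x≢y (λ a≡b → ⊥-elim (a≢b a≡b)) (λ _ → cong (2 *_) v≡))
        (pairCount-≢ unit-3 a b {p} {q} x<m y<m a≢b))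
      (trans (lemma h) (cong (6 *_) (sym m≡)))
      where
      lemma : ∀ h → 2 * suc (2 * h) + (h * 2 + 2 * 2) ≡ 6 * suc h
      lemma = solve-∀

  -- Pairs of points in the edges

  private
    pairBlocks-edges : ∀ μ a p x b q y {T} → x < m → y < m → (a , p , x) ≢ (b , q , y) →
      (a ≡ b → 0 ≡ T) → (a ≢ b → ∀ k → k + m * δ (flat p x) (flat q y) ≡ m → k ≡ T) →
      ∑ (pairBlocks μ) (λ B → proj₂ B (a , p , x) * proj₂ B (b , q , y)) ≡ T
    pairBlocks-edges μ a p x b q y x<m y<m x≢y eq ne = trans (∑-pairBlocks _ μ) (trans
        (classTotals μ μ _ a b S.aligned S.crossed (λ d κ →
          ∑-bilinear params _ _ _ _ refl S.flipped≡aligned refl S.crossed′≡crossed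
            (δᶜ (ends d (μ xor κ) false) a) (δᶜ (ends d (μ xor κ) true) a) (δᶜ (ends d (μ xor κ) false) b) (δᶜ (ends d (μ xor κ) true) b)))
        (same+opposite μ a b
          (λ { refl → trans (cong (3 *_) (S.aligned≡ (λ e → x≢y (cong (a ,_) (flat-injective x<m y<m e))))) (eq refl) })
          (λ a≢b → ne a≢b _ S.crossed≡)))
      where
      module S = EdgeSums (flat-< p x<m) (flat-< q y<m)

    ∑-product : ∀ (c : Bool → Bool → ℕ) (F : Bool → ℕ) →
      ∑[ t₂ ∈ bools ] ∑[ d ∈ bools ] ∑[ t₁ ∈ bools ] (c t₂ t₁ * F d) ≡ (∑[ t₂ ∈ bools ] ∑[ t₁ ∈ bools ] c t₂ t₁) * ∑ bools F
    ∑-product c F = trans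
      (∑-cong bools (λ t₂ → trans (∑-cong bools (λ d → ∑-*ʳ (F d) bools (c t₂))) (∑-*ˡ (∑ bools (c t₂)) bools F)))
      (∑-*ʳ (∑ bools F) bools (λ t₂ → ∑ bools (c t₂)))

    opaque
      unfolding bools

      ∑-classes : ∀ a b → ∑[ t₂ ∈ bools ] ∑[ t₁ ∈ bools ] (δᶜ (t₁ , t₂) a * δᶜ (t₁ , t₂) b) ≡ δᶜ a b
      ∑-classes (a , a′) (b , b′) = from-yes (∀Bool? λ a → ∀Bool? λ a′ → ∀Bool? λ b → ∀Bool? λ b′ →
        ∑[ t₂ ∈ bools ] ∑[ t₁ ∈ bools ] (δᶜ (t₁ , t₂) (a , a′) * δᶜ (t₁ , t₂) (b , b′)) ≟ δᶜ (a , a′) (b , b′)) a a′ b b′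

    -- The factors 2g and 2g + 1 with g < h and the last factor 2h exhaust all v factors; every edge
    -- is repeated for the m translates of its row.
    innerBlocks-edges : ∀ a p x b q y →
      ∑ innerBlocks (λ B → proj₂ B (a , p , x) * proj₂ B (b , q , y)) + ∑ lastBlocks (λ B → proj₂ B (a , p , x) * proj₂ B (b , q , y)) ≡
      δᶜ a b * (m * (∑[ j ∈ upTo v ] ∑[ i ∈ upTo m ] (on j i (flat p x) * on j i (flat q y))))
    innerBlocks-edges a p x b q y = begin
      ∑ innerBlocks f + ∑ lastBlocks f
        ≡⟨ cong₂ _+_ (∑-innerBlocks f) (∑-lastBlocks f) ⟩
      ∑[ g ∈ upTo h ] ∑[ t₂ ∈ bools ] ∑[ d ∈ bools ] ∑[ t₁ ∈ bools ] ∑[ i ∈ upTo m ] ∑[ _ ∈ upTo m ] term t₁ t₂ (bit d + 2 * g) i +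
      ∑[ t₁ ∈ bools ] ∑[ t₂ ∈ bools ] ∑[ i ∈ upTo m ] ∑[ _ ∈ upTo m ] term t₁ t₂ (2 * h) i
        ≡⟨ cong₂ _+_
             (∑-cong (upTo h) (λ g → trans
               (∑-cong bools (λ t₂ → ∑-cong bools (λ d → ∑-cong bools (λ t₁ → collapse t₁ t₂ (bit d + 2 * g)))))
               (trans (∑-product (λ t₂ t₁ → c t₁ t₂) (λ d → m * T (bit d + 2 * g)))
                      (cong₂ _*_ (∑-classes a b) (∑-bools (λ d → m * T (bit d + 2 * g)))))))
             (trans (∑-cong bools (λ t₁ → ∑-cong bools (λ t₂ → collapse t₁ t₂ (2 * h))))
               (trans (∑-swap bools bools _)
               (trans (∑-cong bools (λ t₂ → ∑-*ʳ (m * T (2 * h)) bools (λ t₁ → c t₁ t₂)))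
               (trans (∑-*ʳ (m * T (2 * h)) bools (λ t₂ → ∑[ t₁ ∈ bools ] c t₁ t₂)) (cong (_* (m * T (2 * h))) (∑-classes a b)))))) ⟩
      ∑[ g ∈ upTo h ] (δᶜ a b * (m * T (2 * g) + m * T (1 + 2 * g))) + δᶜ a b * (m * T (2 * h))
        ≡⟨ cong (_+ δᶜ a b * (m * T (2 * h))) (∑-*ˡ (δᶜ a b) (upTo h) _) ⟩
      δᶜ a b * (∑[ g ∈ upTo h ] (m * T (2 * g) + m * T (1 + 2 * g))) + δᶜ a b * (m * T (2 * h))
        ≡⟨ *-distribˡ-+ (δᶜ a b) _ _ ⟨
      δᶜ a b * (∑[ g ∈ upTo h ] (m * T (2 * g) + m * T (1 + 2 * g)) + m * T (2 * h))
        ≡⟨ cong (λ k → δᶜ a b * (k + m * T (2 * h))) (∑-upTo-2* h (λ j → m * T j)) ⟨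
      δᶜ a b * (∑[ j ∈ upTo (2 * h) ] (m * T j) + m * T (2 * h))
        ≡⟨ cong (δᶜ a b *_) (∑-last (2 * h) (λ j → m * T j)) ⟨
      δᶜ a b * (∑[ j ∈ upTo (suc (2 * h)) ] (m * T j))
        ≡⟨ cong (λ k → δᶜ a b * (∑[ j ∈ upTo k ] (m * T j))) v≡ ⟨
      δᶜ a b * (∑[ j ∈ upTo v ] (m * T j))
        ≡⟨ cong (δᶜ a b *_) (∑-*ˡ m (upTo v) T) ⟩
      δᶜ a b * (m * ∑ (upTo v) T) ∎
      where
      open ≡-Reasoning
      f : Weight × Weight → ℕ
      f B = proj₂ B (a , p , x) * proj₂ B (b , q , y)
      T : ℕ → ℕ
      T j = ∑[ i ∈ upTo m ] (on j i (flat p x) * on j i (flat q y))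
      c : Bool → Bool → ℕ
      c t₁ t₂ = δᶜ (t₁ , t₂) a * δᶜ (t₁ , t₂) b
      term : Bool → Bool → ℕ → ℕ → ℕ
      term t₁ t₂ j i = innerEdge (t₁ , t₂) j i (a , p , x) * innerEdge (t₁ , t₂) j i (b , q , y)
      rearrange : ∀ m a b c d → m * (a * b * (c * d)) ≡ a * c * (m * (b * d))
      rearrange = solve-∀
      collapse : ∀ t₁ t₂ j → ∑[ i ∈ upTo m ] ∑[ _ ∈ upTo m ] term t₁ t₂ j i ≡ c t₁ t₂ * (m * T j)
      collapse t₁ t₂ j = trans
        (∑-cong (upTo m) (λ i → trans (∑-const m (term t₁ t₂ j i))
          (rearrange m (δᶜ (t₁ , t₂) a) (on j i (flat p x)) (δᶜ (t₁ , t₂) b) (on j i (flat q y)))))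
        (trans (∑-*ˡ (c t₁ t₂) (upTo m) _) (cong (c t₁ t₂ *_) (∑-*ˡ m (upTo m) _)))

    opaque
      unfolding bools

      ∑-sides : ∀ p q → ∑[ s ∈ bools ] (δᵇ s p * δᵇ s q) ≡ δᵇ p q
      ∑-sides = from-yes (∀Bool? λ p → ∀Bool? λ q → ∑[ s ∈ bools ] (δᵇ s p * δᵇ s q) ≟ δᵇ p q)

    δ-flat : ∀ p q {x y} → x < m → y < m → δᵇ p q * δ x y ≡ δ (flat p x) (flat q y)
    δ-flat false false     x<m y<m = +-identityʳ _
    δ-flat true  true  {x} {y} x<m y<m = trans (+-identityʳ _) (δ-⇔ (cong (m +_)) (+-cancelˡ-≡ m x y))
    δ-flat false true      x<m y<m = sym (δ-≢ (λ e → case flat-injective {false} {true} x<m y<m e of λ ()))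
    δ-flat true  false     x<m y<m = sym (δ-≢ (λ e → case flat-injective {true} {false} x<m y<m e of λ ()))

    rungBlocks-edges : ∀ a p x b q y {T} → x < m → y < m →
      (a ≡ b → 3 * (m * δ (flat p x) (flat q y)) ≡ T) → (a ≢ b → m * δ (flat p x) (flat q y) ≡ T) →
      ∑ rungBlocks (λ B → proj₂ B (a , p , x) * proj₂ B (b , q , y)) ≡ T
    rungBlocks-edges a p x b q y {T} x<m y<m eq ne = trans (∑-rungBlocks _) (trans
        (classTotals false false _ a b U U total) (same+opposite false a b eq ne))
      where
      open ≡-Reasoning
      U : ℕ
      U = m * δ (flat p x) (flat q y)
      rearrange : ∀ m c p x c′ q y → m * (c * (p * x) * (c′ * (q * y))) ≡ c * c′ * (p * q) * m * (x * y)
      rearrange = solve-∀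
      expand : ∀ a b c d p x m → (a + b) * (c + d) * p * m * x ≡ (a * c + b * d) * (m * (p * x)) + (a * d + b * c) * (m * (p * x))
      expand = solve-∀
      total : ∀ d κ → ∑[ s ∈ bools ] ∑[ w ∈ upTo m ] ∑[ _ ∈ upTo m ] (rung d κ s w (a , p , x) * rung d κ s w (b , q , y)) ≡
        (δᶜ (ends d κ false) a * δᶜ (ends d κ false) b + δᶜ (ends d κ true) a * δᶜ (ends d κ true) b) * U +
        (δᶜ (ends d κ false) a * δᶜ (ends d κ true) b + δᶜ (ends d κ true) a * δᶜ (ends d κ false) b) * U
      total d κ = begin
        ∑[ s ∈ bools ] ∑[ w ∈ upTo m ] ∑[ _ ∈ upTo m ] (rung d κ s w (a , p , x) * rung d κ s w (b , q , y))
          ≡⟨ ∑-cong bools (λ s → trans (∑-cong (upTo m) (λ w → trans (∑-const m _)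
               (rearrange m ca (δᵇ s p) (δ w x) cb (δᵇ s q) (δ w y))))
               (trans (∑-*ˡ (ca * cb * (δᵇ s p * δᵇ s q) * m) (upTo m) _)
                 (cong (ca * cb * (δᵇ s p * δᵇ s q) * m *_) (trans (∑-cong (upTo m) (λ w → cong (_* δ w y) (δ-sym w x))) (∑-δ m (λ w → δ w y) x<m))))) ⟩
        ∑[ s ∈ bools ] (ca * cb * (δᵇ s p * δᵇ s q) * m * δ x y)
          ≡⟨ trans (∑-*ʳ (δ x y) bools _) (cong (_* δ x y) (trans (∑-*ʳ m bools _) (cong (_* m) (trans (∑-*ˡ (ca * cb) bools _) (cong (ca * cb *_) (∑-sides p q)))))) ⟩
        ca * cb * δᵇ p q * m * δ x y
          ≡⟨ expand (δᶜ (ends d κ false) a) (δᶜ (ends d κ true) a) (δᶜ (ends d κ false) b) (δᶜ (ends d κ true) b) (δᵇ p q) (δ x y) m ⟩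
        (δᶜ (ends d κ false) a * δᶜ (ends d κ false) b + δᶜ (ends d κ true) a * δᶜ (ends d κ true) b) * (m * (δᵇ p q * δ x y)) +
        (δᶜ (ends d κ false) a * δᶜ (ends d κ true) b + δᶜ (ends d κ true) a * δᶜ (ends d κ false) b) * (m * (δᵇ p q * δ x y))
          ≡⟨ cong (λ k → (δᶜ (ends d κ false) a * δᶜ (ends d κ false) b + δᶜ (ends d κ true) a * δᶜ (ends d κ true) b) * (m * k) +
               (δᶜ (ends d κ false) a * δᶜ (ends d κ true) b + δᶜ (ends d κ true) a * δᶜ (ends d κ false) b) * (m * k)) (δ-flat p q x<m y<m) ⟩
        (δᶜ (ends d κ false) a * δᶜ (ends d κ false) b + δᶜ (ends d κ true) a * δᶜ (ends d κ true) b) * U +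
        (δᶜ (ends d κ false) a * δᶜ (ends d κ true) b + δᶜ (ends d κ true) a * δᶜ (ends d κ false) b) * U ∎
        where
        ca cb : ℕ
        ca = δᶜ (ends d κ false) a + δᶜ (ends d κ true) a
        cb = δᶜ (ends d κ false) b + δᶜ (ends d κ true) b

  -- Inside a class every pair is an edge of one factor. Between classes the cross edges serve
  -- unequal vertices and the rungs equal ones.
  half-edges : ∀ μ {a p x b q y} → x < m → y < m → (a , p , x) ≢ (b , q , y) →
    ∑ (half μ) (λ B → proj₂ B (a , p , x) * proj₂ B (b , q , y)) ≡ m
  half-edges μ {a} {p} {x} {b} {q} {y} x<m y<m x≢y =
    trans (∑-half f μ) (trans (cong (∑ (pairBlocks μ) f +_) (sym (+-assoc (∑ innerBlocks f) _ _)))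
      (trans (cong (λ k → ∑ (pairBlocks μ) f + (k + ∑ rungBlocks f)) (innerBlocks-edges a p x b q y))
        (finish (≡-dec Data.Bool._≟_ Data.Bool._≟_ a b))))
    where
    open ≡-Reasoning
    f : Weight × Weight → ℕ
    f B = proj₂ B (a , p , x) * proj₂ B (b , q , y)
    G : ℕ
    G = ∑[ j ∈ upTo v ] ∑[ i ∈ upTo m ] (on j i (flat p x) * on j i (flat q y))
    finish : Dec (a ≡ b) → ∑ (pairBlocks μ) f + (δᶜ a b * (m * G) + ∑ rungBlocks f) ≡ m
    finish (yes refl) = begin
      ∑ (pairBlocks μ) f + (δᶜ a a * (m * G) + ∑ rungBlocks f)
        ≡⟨ cong₂ _+_ (pairBlocks-edges μ a p x a q y x<m y<m x≢y (λ _ → refl) (λ a≢a → ⊥-elim (a≢a refl)))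
             (cong₂ _+_ (cong₂ (λ k l → k * (m * l)) (δᶜ-refl a)
                 (trans (∑-cong (upTo v) (λ j → ∑-cong (upTo m) (λ i → on*on≡joins j i z≢w)))
                        (count-joins _ _ (flat-< p x<m) (flat-< q y<m) z≢w)))
               (rungBlocks-edges a p x a q y x<m y<m (λ _ → cong (λ k → 3 * (m * k)) (δ-≢ z≢w)) (λ a≢a → ⊥-elim (a≢a refl)))) ⟩
      1 * (m * 1) + 3 * (m * 0)
        ≡⟨ lemma m ⟩
      m ∎
      where
      z≢w : flat p x ≢ flat q y
      z≢w e = x≢y (cong (a ,_) (flat-injective x<m y<m e))
      lemma : ∀ m → 1 * (m * 1) + 3 * (m * 0) ≡ m
      lemma = solve-∀
    finish (no a≢b) = begin
      ∑ (pairBlocks μ) f + (δᶜ a b * (m * G) + ∑ rungBlocks f)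
        ≡⟨ cong₂ (λ k l → ∑ (pairBlocks μ) f + (k * (m * G) + l)) (δᶜ-≢ a b a≢b)
             (rungBlocks-edges a p x b q y x<m y<m (λ a≡b → ⊥-elim (a≢b a≡b)) (λ _ → refl)) ⟩
      ∑ (pairBlocks μ) f + m * δ (flat p x) (flat q y)
        ≡⟨ cong (_+ m * δ (flat p x) (flat q y)) (pairBlocks-edges μ a p x b q y x<m y<m x≢y (λ a≡b → ⊥-elim (a≢b a≡b))
             (λ _ k e → +-cancelʳ-≡ (m * δ (flat p x) (flat q y)) k _ (trans e (sym rest)))) ⟩
      T + m * δ (flat p x) (flat q y)
        ≡⟨ rest ⟩
      m ∎
      where
      T : ℕ
      -- `δ` is at most 1, so nothing is truncated.
      T = m ∸ m * δ (flat p x) (flat q y)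
      rest : T + m * δ (flat p x) (flat q y) ≡ m
      rest = m∸n+n≡m (≤-trans (*-monoʳ-≤ m (δ≤1 (flat p x) (flat q y))) (≤-reflexive (*-identityʳ m)))

  -- Points of quads against points of edges

  meetings : Bool → Class → Class → ℕ
  meetings μ a b = same false μ a b + opposite false μ a b

  private
    opaque
      unfolding bools directions

      -- The class `b` of the edge fixes t₁ and t₂, and the two values of d give complementary
      -- parities in `a`.
      ∑-sides-classes : ∀ p a b → ∑[ t₂ ∈ bools ] ∑[ d ∈ bools ] ∑[ t₁ ∈ bools ] (δᵇ p (side t₂ d t₁ a) * δᶜ (t₁ , t₂) b) ≡ 1
      ∑-sides-classes p (a , a′) (b , b′) = from-yes (∀Bool? λ p → ∀Bool? λ a → ∀Bool? λ a′ → ∀Bool? λ b → ∀Bool? λ b′ →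
        ∑[ t₂ ∈ bools ] ∑[ d ∈ bools ] ∑[ t₁ ∈ bools ] (δᵇ p (side t₂ d t₁ (a , a′)) * δᶜ (t₁ , t₂) (b , b′)) ≟ 1) p a a′ b b′

      -- The edge of the last factor and the three rungs at a point form two couples with
      -- complementary halves, and each couple accounts for 1.
      ∑-sides-rest : ∀ p q a b →
        ∑[ t₁ ∈ bools ] ∑[ t₂ ∈ bools ] (δᵇ p (side t₁ false false a) * δᶜ (t₁ , t₂) b) +
        ∑[ d ∈ directions ] ∑[ κ ∈ bools ] ∑[ s ∈ bools ] (let t₂ , e , t₁ = rungType d κ s in
          δᵇ p (side t₂ e t₁ a) * ((δᶜ (ends d κ false) b + δᶜ (ends d κ true) b) * δᵇ s q)) ≡ 2
      ∑-sides-rest p q (a , a′) (b , b′) = from-yes (∀Bool? λ p → ∀Bool? λ q → ∀Bool? λ a → ∀Bool? λ a′ → ∀Bool? λ b → ∀Bool? λ b′ →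
        ∑[ t₁ ∈ bools ] ∑[ t₂ ∈ bools ] (δᵇ p (side t₁ false false (a , a′)) * δᶜ (t₁ , t₂) (b , b′)) +
        ∑[ d ∈ directions ] ∑[ κ ∈ bools ] ∑[ s ∈ bools ] (let t₂ , e , t₁ = rungType d κ s in
          δᵇ p (side t₂ e t₁ (a , a′)) * ((δᶜ (ends d κ false) (b , b′) + δᶜ (ends d κ true) (b , b′)) * δᵇ s q)) ≟ 2) p q a a′ b b′

  -- Each meeting of the classes contributes v through the partial parallel classes. The other 2h +
  -- 4 edges at a point form h + 2 = m + 1 couples, each covering the point of the quad once.
  half-cross : ∀ μ a p x b q y → x < m → y < m →
    ∑ (half μ) (λ B → proj₁ B (a , p , x) * proj₂ B (b , q , y)) ≡ meetings μ a b * v + suc m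
  half-cross μ a p x b q y x<m y<m = trans (∑-half f μ) (begin
    ∑ (pairBlocks μ) f + (∑ innerBlocks f + (∑ lastBlocks f + ∑ rungBlocks f))
      ≡⟨ cong₂ _+_ pairs (cong₂ _+_ inner (trans (cong₂ _+_ last rungs) (∑-sides-rest p q a b))) ⟩
    meetings μ a b * v + (h + 2)
      ≡⟨ cong (meetings μ a b * v +_) (trans (+-comm h 2) (cong suc (sym m≡))) ⟩
    meetings μ a b * v + suc m ∎)
    where
    open ≡-Reasoning
    open CrossSums (flat-< p x<m) (flat-< q y<m)
    f : Weight × Weight → ℕ
    f B = proj₁ B (a , p , x) * proj₂ B (b , q , y)
    pairs : ∑ (pairBlocks μ) f ≡ meetings μ a b * v
    pairs = trans (∑-pairBlocks f μ) (trans
      (classTotals false μ _ a b v v (λ d κ → ∑-bilinear params _ _ _ _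
        (∑-on-E (λ q i → i) id plain straight) (∑-on-E (λ q i → (i + q) % m) not shifted flipped)
        (∑-on-E (λ q i → i) not plain flipped) (∑-on-E (λ q i → (i + q) % m) id shifted straight)
        (δᶜ (ends d κ false) a) (δᶜ (ends d κ true) a) (δᶜ (ends d (μ xor κ) false) b) (δᶜ (ends d (μ xor κ) true) b)))
      (sym (*-distribʳ-+ v (same false μ a b) (opposite false μ a b))))
    translates : ∀ t₂ d t₁ k (e : Weight) → ∑-transversals f (t₂ , d , t₁) k e ≡ δᵇ p (side t₂ d t₁ a) * e (b , q , y)
    translates t₂ d t₁ k e = trans (∑-*ʳ (e (b , q , y)) (upTo m) _)
      (cong (_* e (b , q , y)) (∑-transversal t₂ d t₁ k {a} {p} x<m))
    innerEdges : ∀ t₂ d t₁ c j → ∑[ i ∈ upTo m ] ∑-transversals f (t₂ , d , t₁) i (innerEdge c j i) ≡ δᵇ p (side t₂ d t₁ a) * δᶜ c b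
    innerEdges t₂ d t₁ c j = trans (∑-cong (upTo m) (λ i → translates t₂ d t₁ i (innerEdge c j i)))
      (trans (∑-*ˡ (δᵇ p (side t₂ d t₁ a)) (upTo m) _) (cong (δᵇ p (side t₂ d t₁ a) *_)
        (trans (∑-*ˡ (δᶜ c b) (upTo m) _) (trans (cong (δᶜ c b *_) (count-on j (flat q y) (flat-< q y<m))) (*-identityʳ _)))))
    inner : ∑ innerBlocks f ≡ h
    inner = trans (∑-innerBlocks f) (trans
      (∑-cong (upTo h) (λ g → trans
        (∑-cong bools (λ t₂ → ∑-cong bools (λ d → ∑-cong bools (λ t₁ → innerEdges t₂ d t₁ (t₁ , t₂) (bit d + 2 * g)))))
        (∑-sides-classes p a b)))
      (trans (∑-const h 1) (*-identityʳ h)))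
    last : ∑ lastBlocks f ≡ ∑[ t₁ ∈ bools ] ∑[ t₂ ∈ bools ] (δᵇ p (side t₁ false false a) * δᶜ (t₁ , t₂) b)
    last = trans (∑-lastBlocks f) (∑-cong bools (λ t₁ → ∑-cong bools (λ t₂ → innerEdges t₁ false false (t₁ , t₂) (2 * h))))
    rungs : ∑ rungBlocks f ≡ ∑[ d ∈ directions ] ∑[ κ ∈ bools ] ∑[ s ∈ bools ] (let t₂ , e , t₁ = rungType d κ s in
      δᵇ p (side t₂ e t₁ a) * ((δᶜ (ends d κ false) b + δᶜ (ends d κ true) b) * δᵇ s q))
    rungs = trans (∑-rungBlocks f) (∑-cong directions (λ d → ∑-cong bools (λ κ → ∑-cong bools (λ s →
      let t₂ , e , t₁ = rungType d κ s
          P = δᵇ p (side t₂ e t₁ a)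
          c = δᶜ (ends d κ false) b + δᶜ (ends d κ true) b
      in trans (∑-cong (upTo m) (λ w → translates t₂ e t₁ w (rung d κ s w)))
        (trans (∑-*ˡ P (upTo m) _) (cong (P *_) (trans (∑-*ˡ c (upTo m) _) (cong (c *_)
          (trans (∑-*ˡ (δᵇ s q) (upTo m) _) (trans (cong (δᵇ s q *_)
            (trans (∑-cong (upTo m) (λ w → trans (δ-sym w y) (sym (*-identityʳ _)))) (∑-δ m (λ _ → 1) y<m))) (*-identityʳ _)))))))))))

  -- Block sizes and replication numbers

  points : List Point
  points = collect bools λ a₁ → collect bools λ a₂ → collect bools λ p → map (λ x → (a₁ , a₂) , p , x) (upTo m)

  ∑-points : ∀ f → ∑ points f ≡ ∑[ a₁ ∈ bools ] ∑[ a₂ ∈ bools ] ∑[ p ∈ bools ] ∑[ x ∈ upTo m ] f ((a₁ , a₂) , p , x)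
  ∑-points f = ∑-collect bools _ λ a₁ → ∑-collect bools _ λ a₂ → ∑-collect bools _ λ p → ∑-map _ (upTo m) f

  Valid : Point → Set
  Valid (_ , _ , x) = x < m

  record Proper (w : Weight) (k : ℕ) : Set where
    field
      ≤1   : ∀ {x} → Valid x → w x ≤ 1
      size : ∑ points w ≡ k

  private
    opaque
      unfolding bools directions

      All-directions : ∀ {P : Direction → Set} → (∀ d → P d) → All P directions
      All-directions P = P I ∷ P II ∷ P III ∷ []

      ∑-δᶜ : ∀ a → ∑[ a₁ ∈ bools ] ∑[ a₂ ∈ bools ] δᶜ a (a₁ , a₂) ≡ 1
      ∑-δᶜ (a , a′) = from-yes (∀Bool? λ a → ∀Bool? λ a′ → ∑[ a₁ ∈ bools ] ∑[ a₂ ∈ bools ] δᶜ (a , a′) (a₁ , a₂) ≟ 1) a a′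

      ∑-δᵇ : ∀ s → ∑[ p ∈ bools ] δᵇ s p ≡ 1
      ∑-δᵇ = from-yes (∀Bool? λ s → ∑[ p ∈ bools ] δᵇ s p ≟ 1)

      ∑-δᵇ′ : ∀ s → ∑[ p ∈ bools ] δᵇ p s ≡ 1
      ∑-δᵇ′ = from-yes (∀Bool? λ s → ∑[ p ∈ bools ] δᵇ p s ≟ 1)

    ends≤1 : ∀ d κ c → δᶜ (ends d κ false) c + δᶜ (ends d κ true) c ≤ 1
    ends≤1 I   κ (c , c′) = from-yes (∀Bool? λ κ → ∀Bool? λ c → ∀Bool? λ c′ → δᶜ (ends I κ false) (c , c′) + δᶜ (ends I κ true) (c , c′) ≤? 1) κ c c′
    ends≤1 II  κ (c , c′) = from-yes (∀Bool? λ κ → ∀Bool? λ c → ∀Bool? λ c′ → δᶜ (ends II κ false) (c , c′) + δᶜ (ends II κ true) (c , c′) ≤? 1) κ c c′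
    ends≤1 III κ (c , c′) = from-yes (∀Bool? λ κ → ∀Bool? λ c → ∀Bool? λ c′ → δᶜ (ends III κ false) (c , c′) + δᶜ (ends III κ true) (c , c′) ≤? 1) κ c c′

    δᵇ≤1 : ∀ p q → δᵇ p q ≤ 1
    δᵇ≤1 = from-yes (∀Bool? λ p → ∀Bool? λ q → δᵇ p q ≤? 1)

    δᶜ≤1 : ∀ a b → δᶜ a b ≤ 1
    δᶜ≤1 (a , a′) (b , b′) = *-mono-≤ (δᵇ≤1 a b) (δᵇ≤1 a′ b′)

    combination≤1 : ∀ {a b k l} → a + b ≤ 1 → k ≤ 1 → l ≤ 1 → a * k + b * l ≤ 1
    combination≤1 {a} {b} {k} {l} a+b≤1 k≤1 l≤1 = begin
      a * k + b * l  ≤⟨ +-mono-≤ (*-monoʳ-≤ a k≤1) (*-monoʳ-≤ b l≤1) ⟩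
      a * 1 + b * 1  ≡⟨ cong₂ _+_ (*-identityʳ a) (*-identityʳ b) ⟩
      a + b          ≤⟨ a+b≤1 ⟩
      1              ∎
      where open ≤-Reasoning

    ∑-inClass : ∀ a g → ∑ points (λ (c , p , x) → δᶜ a c * g (flat p x)) ≡ ∑ (upTo (suc v)) g
    ∑-inClass a g = begin
      ∑ points (λ (c , p , x) → δᶜ a c * g (flat p x))
        ≡⟨ ∑-points _ ⟩
      ∑[ a₁ ∈ bools ] ∑[ a₂ ∈ bools ] ∑[ p ∈ bools ] ∑[ x ∈ upTo m ] (δᶜ a (a₁ , a₂) * g (flat p x))
        ≡⟨ ∑-cong bools (λ a₁ → trans (∑-cong bools (λ a₂ → trans
             (∑-cong bools (λ p → ∑-*ˡ (δᶜ a (a₁ , a₂)) (upTo m) (λ x → g (flat p x))))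
             (∑-*ˡ (δᶜ a (a₁ , a₂)) bools _))) (∑-*ʳ G bools (λ a₂ → δᶜ a (a₁ , a₂)))) ⟩
      ∑[ a₁ ∈ bools ] ((∑[ a₂ ∈ bools ] δᶜ a (a₁ , a₂)) * G)
        ≡⟨ trans (∑-*ʳ G bools _) (trans (cong (_* G) (∑-δᶜ a)) (*-identityˡ G)) ⟩
      G
        ≡⟨ ∑-bools _ ⟩
      ∑ (upTo m) g + ∑[ x ∈ upTo m ] g (m + x)
        ≡⟨ ∑-upTo-+ m m g ⟨
      ∑ (upTo (m + m)) g
        ≡⟨ cong (λ k → ∑ (upTo k) g) 2m≡ ⟩
      ∑ (upTo (suc v)) g ∎
      where
      open ≡-Reasoning
      G : ℕ
      G = ∑[ p ∈ bools ] ∑[ x ∈ upTo m ] g (flat p x)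

    ∑-E : ∀ j q σ → ∑[ z ∈ upTo (suc v) ] δ (E j q σ) z ≡ 1
    ∑-E j q σ = trans (∑-cong (upTo (suc v)) (λ z → sym (*-identityʳ _))) (∑-δ (suc v) (λ _ → 1) (E-< j q σ))

    ∑-on : ∀ j q → ∑[ z ∈ upTo (suc v) ] on j q z ≡ 2
    ∑-on j q = trans (∑-+ (upTo (suc v)) (δ (E j q false)) (δ (E j q true))) (cong₂ _+_ (∑-E j q false) (∑-E j q true))

    doublePair-proper : ∀ d κ j {q r} → q < m → r < m → Proper (doublePair (ends d κ false) (ends d κ true) j q r) 4
    doublePair-proper d κ j {q} {r} q<m r<m = record
      { ≤1   = λ { {c , p , x} x<m → combination≤1 {δᶜ (ends d κ false) c} (ends≤1 d κ c)
                     (on≤1 j q _ q<m (flat-< p x<m)) (on≤1 j r _ r<m (flat-< p x<m)) }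
      ; size = trans (∑-+ points _ _) (cong₂ _+_
                 (trans (∑-inClass (ends d κ false) (on j q)) (∑-on j q)) (trans (∑-inClass (ends d κ true) (on j r)) (∑-on j r)))
      }

    crossEdge-proper : ∀ d κ j q τ → Proper (crossEdge (ends d κ false) (ends d κ true) j q τ) 2
    crossEdge-proper d κ j q τ = record
      { ≤1   = λ { {c , p , x} _ → combination≤1 {δᶜ (ends d κ false) c} (ends≤1 d κ c)
                     (δ≤1 (E j q τ) (flat p x)) (δ≤1 (E j q (not τ)) (flat p x)) }
      ; size = trans (∑-+ points _ _) (cong₂ _+_
                 (trans (∑-inClass (ends d κ false) (δ (E j q τ))) (∑-E j q τ))
                 (trans (∑-inClass (ends d κ true) (δ (E j q (not τ)))) (∑-E j q (not τ))))
      }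

    innerEdge-proper : ∀ a j {q} → q < m → Proper (innerEdge a j q) 2
    innerEdge-proper a j {q} q<m = record
      { ≤1   = λ { {c , p , x} x<m → *-mono-≤ (δᶜ≤1 a c) (on≤1 j q _ q<m (flat-< p x<m)) }
      ; size = trans (∑-inClass a (on j q)) (∑-on j q)
      }

    ∑-δ-upTo : ∀ {w} → w < m → ∑[ x ∈ upTo m ] δ w x ≡ 1
    ∑-δ-upTo w<m = trans (∑-cong (upTo m) (λ x → sym (*-identityʳ _))) (∑-δ m (λ _ → 1) w<m)

    rung-proper : ∀ d κ s {w} → w < m → Proper (rung d κ s w) 2
    rung-proper d κ s {w} w<m = record
      { ≤1   = λ { {c , p , x} _ → *-mono-≤ (ends≤1 d κ c) (*-mono-≤ (δᵇ≤1 s p) (δ≤1 w x)) }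
      ; size = trans (∑-points _) (trans
          (∑-cong bools (λ a₁ → ∑-cong bools (λ a₂ → trans
            (∑-cong bools (λ p → ∑-*ˡ (c (a₁ , a₂)) (upTo m) _))
            (trans (∑-*ˡ (c (a₁ , a₂)) bools _) (trans (cong (c (a₁ , a₂) *_) one) (*-identityʳ _))))))
          (trans (∑-cong bools (λ a₁ → ∑-+ bools _ _)) (trans (∑-+ bools _ _)
            (cong₂ _+_ (∑-δᶜ (ends d κ false)) (∑-δᶜ (ends d κ true))))))
      }
      where
      c : Class → ℕ
      c a = δᶜ (ends d κ false) a + δᶜ (ends d κ true) a
      one : ∑[ p ∈ bools ] ∑[ x ∈ upTo m ] (δᵇ s p * δ w x) ≡ 1
      one = trans (∑-cong bools (λ p → trans (∑-*ˡ (δᵇ s p) (upTo m) _) (trans (cong (δᵇ s p *_) (∑-δ-upTo w<m)) (*-identityʳ _))))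
                  (∑-δᵇ s)

    transversal-proper : ∀ t₂ d t₁ k i → Proper (transversal t₂ d t₁ k i) 4
    transversal-proper t₂ d t₁ k i = record
      { ≤1   = λ { {c , p , x} _ → *-mono-≤ (δᵇ≤1 p (side t₂ d t₁ c)) (δ≤1 ((i + offset c t₂ k) % m) x) }
      ; size = trans (∑-points _) (trans
          (∑-cong bools (λ a₁ → trans (∑-cong bools (λ a₂ → one (a₁ , a₂))) (∑-bools-const 1))) (∑-bools-const 2))
      }
      where
      one : ∀ a → ∑[ p ∈ bools ] ∑[ x ∈ upTo m ] transversal t₂ d t₁ k i (a , p , x) ≡ 1
      one a = trans (∑-cong bools (λ p → trans (∑-*ˡ (δᵇ p (side t₂ d t₁ a)) (upTo m) _)
        (trans (cong (δᵇ p (side t₂ d t₁ a) *_) (∑-δ-upTo (m%n<n (i + offset a t₂ k) m))) (*-identityʳ _)))) (∑-δᵇ′ (side t₂ d t₁ a))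

  ProperBlock : Weight × Weight → Set
  ProperBlock (Q , e) = Proper Q 4 × Proper e 2

  All-collect : ∀ {P : Y → Set} {xs : List X} {g : X → List Y} → All (λ x → All P (g x)) xs → All P (collect xs g)
  All-collect ps = Allₚ.concat⁺ (Allₚ.map⁺ ps)

  private
    All-upTo : ∀ {P : ℕ → Set} n → (∀ i → i < n → P i) → All P (upTo n)
    All-upTo n p = Allₚ.applyUpTo⁺₁ id n (λ {i} → p i)

    params-< : All (λ (j , q , τ , i) → i < m) params
    params-< = All-collect (All-upTo v λ j _ → All-collect (All-upTo m λ q _ → All-collect (All-bools λ τ →
      Allₚ.map⁺ (All-upTo m λ i i<m → i<m))))

    transversals-proper : ∀ t k e → Proper e 2 → All ProperBlock (transversals t k e)
    transversals-proper (t₂ , d , t₁) k e pe = Allₚ.map⁺ (All-upTo m λ i _ → transversal-proper t₂ d t₁ k i , pe)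

  half-proper : ∀ μ → All ProperBlock (half μ)
  half-proper μ = Allₚ.++⁺
    (All-collect (All-directions λ d → All-collect (All-bools λ κ → Allₚ.map⁺ (All.map
      (λ { {j , q , τ , i} i<m → doublePair-proper d κ j i<m (m%n<n (i + q) m) , crossEdge-proper d (μ xor κ) j q τ }) params-<))))
    (Allₚ.++⁺
      (All-collect (All-upTo h λ g _ → All-collect (All-bools λ t₂ → All-collect (All-bools λ d → All-collect (All-bools λ t₁ →
        All-collect (All-upTo m λ q q<m → transversals-proper (t₂ , d , t₁) q _ (innerEdge-proper (t₁ , t₂) (bit d + 2 * g) q<m)))))))
      (Allₚ.++⁺
        (All-collect (All-bools λ t₁ → All-collect (All-bools λ t₂ → All-collect (All-upTo m λ q q<m →
          transversals-proper (t₁ , false , false) q _ (innerEdge-proper (t₁ , t₂) (2 * h) q<m)))))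
        (All-collect (All-directions λ d → All-collect (All-bools λ κ → All-collect (All-bools λ s → All-collect (All-upTo m λ w w<m →
          transversals-proper (rungType d κ s) w _ (rung-proper d κ s w<m))))))))

  private
    points-valid : All Valid points
    points-valid = All-collect (All-bools λ a₁ → All-collect (All-bools λ a₂ → All-collect (All-bools λ p →
      Allₚ.map⁺ (All-upTo m λ x x<m → x<m))))

    ∑-byClass : ∀ (k : Class → ℕ) → ∑ points (λ (c , p , x) → k c) ≡ (∑[ a₁ ∈ bools ] ∑[ a₂ ∈ bools ] k (a₁ , a₂)) * (2 * m)
    ∑-byClass k = trans (∑-points _) (trans
      (∑-cong bools (λ a₁ → trans (∑-cong bools (λ a₂ → trans
        (∑-cong bools (λ p → ∑-const m (k (a₁ , a₂)))) (trans (∑-bools-const (m * k (a₁ , a₂))) (lemma m (k (a₁ , a₂))))))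
        (∑-*ʳ (2 * m) bools _)))
      (∑-*ʳ (2 * m) bools _))
      where
      lemma : ∀ m k → 2 * (m * k) ≡ k * (2 * m)
      lemma = solve-∀

    ∑-meetings : ∀ (k : Class → ℕ) → ∑[ a₁ ∈ bools ] ∑[ a₂ ∈ bools ] k (a₁ , a₂) ≡ 6 →
      ∑ points (λ (c , p , x) → k c * v + suc m) ≡ (6 * v + 4 * suc m) * (2 * m)
    ∑-meetings k e = trans (∑-byClass (λ c → k c * v + suc m)) (cong (_* (2 * m)) (trans
      (∑-cong bools (λ a₁ → trans (∑-+ bools _ _) (cong₂ _+_ (∑-*ʳ v bools _) (∑-bools-const (suc m)))))
      (trans (∑-+ bools _ _) (cong₂ _+_ (trans (∑-*ʳ v bools _) (cong (_* v) e))
        (trans (∑-bools-const (2 * suc m)) (sym (*-assoc 2 2 (suc m))))))))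

  -- Double counting: a block has two edge points, so summing `half-cross` over all edge points
  -- counts every quad through `x` twice.
  half-quads-at : ∀ μ {x} → Valid x → ∑ (half μ) (λ B → proj₁ B x) ≡ m * (6 * v + 4 * suc m)
  half-quads-at μ {x@(a , p , i)} i<m = *-cancelʳ-≡ _ _ 2 (begin
    ∑ (half μ) (λ B → proj₁ B x) * 2
      ≡⟨ ∑-*ʳ 2 (half μ) _ ⟨
    ∑ (half μ) (λ B → proj₁ B x * 2)
      ≡⟨ ∑-cong-All (All.map (λ { {Q , e} (_ , pe) → cong (Q x *_) (sym (Proper.size pe)) }) (half-proper μ)) ⟩
    ∑ (half μ) (λ B → proj₁ B x * ∑ points (proj₂ B))
      ≡⟨ ∑-cong (half μ) (λ B → sym (∑-*ˡ (proj₁ B x) points (proj₂ B))) ⟩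
    ∑[ B ∈ half μ ] ∑[ y ∈ points ] (proj₁ B x * proj₂ B y)
      ≡⟨ ∑-swap (half μ) points _ ⟩
    ∑[ y ∈ points ] ∑[ B ∈ half μ ] (proj₁ B x * proj₂ B y)
      ≡⟨ ∑-cong-All (All.map (λ { {b , q , y} y<m → half-cross μ a p i b q y i<m y<m }) points-valid) ⟩
    ∑ points (λ (b , q , y) → meetings μ a b * v + suc m)
      ≡⟨ ∑-meetings (meetings μ a) (∑-directions-≡6′ μ a) ⟩
    (6 * v + 4 * suc m) * (2 * m)
      ≡⟨ lemma (6 * v + 4 * suc m) m ⟩
    m * (6 * v + 4 * suc m) * 2 ∎)
    where
    open ≡-Reasoning
    lemma : ∀ k m → k * (2 * m) ≡ m * k * 2
    lemma = solve-∀

  -- The same double counting from the other side, with four quad points in a block.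
  half-edges-at : ∀ μ {y} → Valid y → ∑ (half μ) (λ B → proj₂ B y) ≡ m * (3 * v + 2 * suc m)
  half-edges-at μ {y@(b , q , i)} i<m = *-cancelˡ-≡ _ _ 4 (begin
    4 * ∑ (half μ) (λ B → proj₂ B y)
      ≡⟨ ∑-*ˡ 4 (half μ) _ ⟨
    ∑ (half μ) (λ B → 4 * proj₂ B y)
      ≡⟨ ∑-cong-All (All.map (λ { {Q , e} (pQ , _) → cong (_* e y) (sym (Proper.size pQ)) }) (half-proper μ)) ⟩
    ∑ (half μ) (λ B → ∑ points (proj₁ B) * proj₂ B y)
      ≡⟨ ∑-cong (half μ) (λ B → sym (∑-*ʳ (proj₂ B y) points (proj₁ B))) ⟩
    ∑[ B ∈ half μ ] ∑[ x ∈ points ] (proj₁ B x * proj₂ B y)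
      ≡⟨ ∑-swap (half μ) points _ ⟩
    ∑[ x ∈ points ] ∑[ B ∈ half μ ] (proj₁ B x * proj₂ B y)
      ≡⟨ ∑-cong-All (All.map (λ { {a , p , x} x<m → half-cross μ a p x b q i x<m i<m }) points-valid) ⟩
    ∑ points (λ (a , p , x) → meetings μ a b * v + suc m)
      ≡⟨ ∑-meetings (λ a → meetings μ a b) (∑-directions-≡6 μ b) ⟩
    (6 * v + 4 * suc m) * (2 * m)
      ≡⟨ lemma v m ⟩
    4 * (m * (3 * v + 2 * suc m)) ∎)
    where
    open ≡-Reasoning
    lemma : ∀ v m → (6 * v + 4 * suc m) * (2 * m) ≡ 4 * (m * (3 * v + 2 * suc m))
    lemma = solve-∀

-- Weights on Fin n as subsets

ind : Bool → ℕ
ind b = if b then 1 else 0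

∑-allFin-suc : ∀ n (f : Fin (suc n) → ℕ) → ∑ (allFin (suc n)) f ≡ f zero + ∑[ i ∈ allFin n ] f (suc i)
∑-allFin-suc n f = cong (f zero +_) (go n suc)
  where
  go : ∀ {k} n (g : Fin n → Fin k) {f : Fin k → ℕ} → ∑ (tabulate g) f ≡ ∑[ i ∈ allFin n ] f (g i)
  go zero    g     = refl
  go (suc n) g {f} = cong (f (g zero) +_) (trans (go n (g ∘ suc)) (sym (go n suc)))

∑-allFin-+ : ∀ a b (f : Fin (a + b) → ℕ) →
  ∑ (allFin (a + b)) f ≡ ∑[ i ∈ allFin a ] f (i ↑ˡ b) + ∑[ j ∈ allFin b ] f (a ↑ʳ j)
∑-allFin-+ zero    b f = refl
∑-allFin-+ (suc a) b f = begin
  ∑ (allFin (suc a + b)) f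
    ≡⟨ ∑-allFin-suc (a + b) f ⟩
  f zero + ∑ (allFin (a + b)) (f ∘ suc)
    ≡⟨ cong (f zero +_) (∑-allFin-+ a b (f ∘ suc)) ⟩
  f zero + (∑[ i ∈ allFin a ] f (suc (i ↑ˡ b)) + rest)
    ≡⟨ +-assoc (f zero) _ rest ⟨
  f zero + ∑[ i ∈ allFin a ] f (suc (i ↑ˡ b)) + rest
    ≡⟨ cong (_+ rest) (∑-allFin-suc a (λ i → f (i ↑ˡ b))) ⟨
  ∑[ i ∈ allFin (suc a) ] f (i ↑ˡ b) + rest ∎
  where
  open ≡-Reasoning
  rest : ℕ
  rest = ∑[ j ∈ allFin b ] f (suc a ↑ʳ j)

∑-allFin-* : ∀ a b (f : Fin (a * b) → ℕ) → ∑ (allFin (a * b)) f ≡ ∑[ i ∈ allFin a ] ∑[ j ∈ allFin b ] f (combine i j)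
∑-allFin-* zero    b f = refl
∑-allFin-* (suc a) b f = begin
  ∑ (allFin (b + a * b)) f
    ≡⟨ ∑-allFin-+ b (a * b) f ⟩
  ∑[ j ∈ allFin b ] f (j ↑ˡ (a * b)) + ∑[ k ∈ allFin (a * b) ] f (b ↑ʳ k)
    ≡⟨ cong (∑[ j ∈ allFin b ] f (j ↑ˡ (a * b)) +_) (∑-allFin-* a b (λ k → f (b ↑ʳ k))) ⟩
  ∑[ j ∈ allFin b ] f (j ↑ˡ (a * b)) + ∑[ i ∈ allFin a ] ∑[ j ∈ allFin b ] f (b ↑ʳ combine i j)
    ≡⟨ ∑-allFin-suc a (λ i → ∑[ j ∈ allFin b ] f (combine i j)) ⟨
  ∑[ i ∈ allFin (suc a) ] ∑[ j ∈ allFin b ] f (combine i j) ∎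
  where open ≡-Reasoning

∑-allFin-toℕ : ∀ n (f : ℕ → ℕ) → ∑[ i ∈ allFin n ] f (toℕ i) ≡ ∑ (upTo n) f
∑-allFin-toℕ zero    f = refl
∑-allFin-toℕ (suc n) f = trans (∑-allFin-suc n (f ∘ toℕ)) (trans (cong (f 0 +_) (∑-allFin-toℕ n (f ∘ suc))) (sym (∑-suc n f)))

length-filter : ∀ {P : X → Set} (P? : ∀ x → Dec (P x)) xs → length (filter P? xs) ≡ ∑[ x ∈ xs ] ind (does (P? x))
length-filter P? []       = refl
length-filter P? (x ∷ xs) with does (P? x)
... | true  = cong suc (length-filter P? xs)
... | false = length-filter P? xs

ind-∧ : ∀ a b → ind (a ∧ b) ≡ ind a * ind b
ind-∧ false b = refl
ind-∧ true  b = sym (+-identityʳ (ind b))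

∣tabulate∣ : ∀ {n} (f : Fin n → Bool) → ∣ Vec.tabulate f ∣ ≡ ∑[ x ∈ allFin n ] ind (f x)
∣tabulate∣ {zero}  f = refl
∣tabulate∣ {suc n} f = trans (head (f zero)) (sym (∑-allFin-suc n (ind ∘ f)))
  where
  head : ∀ b → ∣ b Vec.∷ Vec.tabulate (f ∘ suc) ∣ ≡ ind b + ∑[ x ∈ allFin n ] ind (f (suc x))
  head false = ∣tabulate∣ (f ∘ suc)
  head true  = cong suc (∣tabulate∣ (f ∘ suc))

tabulate-∩ : ∀ {n} (f g : Fin n → Bool) → Vec.tabulate f ∩ Vec.tabulate g ≡ Vec.tabulate (λ x → f x ∧ g x)
tabulate-∩ {zero}  f g = refl
tabulate-∩ {suc n} f g = cong (f zero ∧ g zero Vec.∷_) (tabulate-∩ (f ∘ suc) (g ∘ suc))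

∈?-tabulate : ∀ {n} (f : Fin n → Bool) x → does (x ∈? Vec.tabulate f) ≡ f x
∈?-tabulate f zero with f zero
... | true  = refl
... | false = refl
∈?-tabulate f (suc x) = ∈?-tabulate (f ∘ suc) x

support : ∀ {n} → (Fin n → ℕ) → Subset n
support w = Vec.tabulate (λ x → 0 <ᵇ w x)

ind-<ᵇ : ∀ {k} → k ≤ 1 → ind (0 <ᵇ k) ≡ k
ind-<ᵇ z≤n       = refl
ind-<ᵇ (s≤s z≤n) = refl

∣support∣ : ∀ {n} {w : Fin n → ℕ} → (∀ x → w x ≤ 1) → ∣ support w ∣ ≡ ∑ (allFin n) w
∣support∣ {n} {w} w≤1 = trans (∣tabulate∣ (λ x → 0 <ᵇ w x)) (∑-cong (allFin n) (λ x → ind-<ᵇ (w≤1 x)))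

∣support∩∣ : ∀ {n} {w : Fin n → ℕ} → (∀ x → w x ≤ 1) → ∀ (f : Fin n → Bool) →
  ∣ support w ∩ Vec.tabulate f ∣ ≡ ∑[ x ∈ allFin n ] (w x * ind (f x))
∣support∩∣ {n} {w} w≤1 f = trans (cong ∣_∣ (tabulate-∩ (λ x → 0 <ᵇ w x) f)) (trans (∣tabulate∣ (λ x → (0 <ᵇ w x) ∧ f x))
  (∑-cong (allFin n) (λ x → trans (ind-∧ (0 <ᵇ w x) (f x)) (cong (_* ind (f x)) (ind-<ᵇ (w≤1 x))))))

replication≡ : ∀ {n} {ws : List (Fin n → ℕ)} → All (λ w → ∀ x → w x ≤ 1) ws → ∀ x →
  replication (map support ws) x ≡ ∑[ w ∈ ws ] w x
replication≡ {ws = ws} ws≤1 x = trans (length-filter (λ B → x ∈? B) (map support ws)) (trans (∑-map support ws _)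
  (∑-cong-All (All.map (λ {w} w≤1 → trans (cong ind (∈?-tabulate (λ z → 0 <ᵇ w z) x)) (ind-<ᵇ (w≤1 x))) ws≤1)))

-- For values at most 1 the truth value of `0 <ᵇ w x` is `w x` itself, and conjunction becomes
-- multiplication.
concurrence≡ : ∀ {n} {ws : List (Fin n → ℕ)} → All (λ w → ∀ x → w x ≤ 1) ws → ∀ x y →
  concurrence (map support ws) x y ≡ ∑[ w ∈ ws ] (w x * w y)
concurrence≡ {ws = ws} ws≤1 x y = trans (length-filter (λ B → (x ∈? B) ×-dec (y ∈? B)) (map support ws)) (trans (∑-map support ws _)
  (∑-cong-All (All.map (λ {w} w≤1 → trans (ind-∧ (does (x ∈? support w)) (does (y ∈? support w))) (cong₂ _*_
    (trans (cong ind (∈?-tabulate (λ z → 0 <ᵇ w z) x)) (ind-<ᵇ (w≤1 x)))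
    (trans (cong ind (∈?-tabulate (λ z → 0 <ᵇ w z) y)) (ind-<ᵇ (w≤1 y))))) ws≤1)))

-- Numbering of the points

bits : Fin 8 → Class × Bool
bits 0F = (false , false) , false
bits 1F = (false , false) , true
bits 2F = (false , true)  , false
bits 3F = (false , true)  , true
bits 4F = (true  , false) , false
bits 5F = (true  , false) , true
bits 6F = (true  , true)  , false
bits 7F = (true  , true)  , true

unbits : Class × Bool → Fin 8
unbits ((false , false) , false) = 0F
unbits ((false , false) , true)  = 1F
unbits ((false , true)  , false) = 2F
unbits ((false , true)  , true)  = 3F
unbits ((true  , false) , false) = 4F
unbits ((true  , false) , true)  = 5F
unbits ((true  , true)  , false) = 6F
unbits ((true  , true)  , true)  = 7F

unbits-bits : ∀ e → unbits (bits e) ≡ e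
unbits-bits 0F = refl
unbits-bits 1F = refl
unbits-bits 2F = refl
unbits-bits 3F = refl
unbits-bits 4F = refl
unbits-bits 5F = refl
unbits-bits 6F = refl
unbits-bits 7F = refl

opaque
  unfolding bools

  ∑-bits : ∀ (G : Class × Bool → ℕ) → ∑[ e ∈ allFin 8 ] G (bits e) ≡ ∑[ a₁ ∈ bools ] ∑[ a₂ ∈ bools ] ∑[ p ∈ bools ] G ((a₁ , a₂) , p)
  ∑-bits G = lemma (G (bits 0F)) (G (bits 1F)) (G (bits 2F)) (G (bits 3F)) (G (bits 4F)) (G (bits 5F)) (G (bits 6F)) (G (bits 7F))
    where
    lemma : ∀ a b c d e f g k → a + (b + (c + (d + (e + (f + (g + (k + 0))))))) ≡
      a + (b + 0) + (c + (d + 0) + 0) + (e + (f + 0) + (g + (k + 0) + 0) + 0)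
    lemma = solve-∀

-- Assembly of the two halves

module Assembly (h m v : ℕ) .{{_ : NonZero m}} .{{_ : NonZero v}} (m≡ : m ≡ suc h) (v≡ : v ≡ suc (2 * h))
                (unit-3 : Modular.Unit m 3) where
  open HalfDesign h m v m≡ v≡

  decode : Fin (m * 8) → Point
  decode y = proj₁ (bits (remainder {m} 8 y)) , proj₂ (bits (remainder {m} 8 y)) , toℕ (quotient {m} 8 y)

  decode-valid : ∀ y → Valid (decode y)
  decode-valid y = toℕ<n (quotient {m} 8 y)

  remQuot-injective : ∀ {a} b {x y : Fin (a * b)} → quotient {a} b x ≡ quotient {a} b y → remainder {a} b x ≡ remainder {a} b y → x ≡ y
  remQuot-injective {a} b {x} {y} eq er = begin
    x                                            ≡⟨ combine-remQuot {a} b x ⟨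
    combine (quotient {a} b x) (remainder {a} b x)  ≡⟨ cong₂ combine eq er ⟩
    combine (quotient {a} b y) (remainder {a} b y)  ≡⟨ combine-remQuot {a} b y ⟩
    y                                            ∎
    where open ≡-Reasoning

  decode-injective : ∀ {x y} → decode x ≡ decode y → x ≡ y
  decode-injective {x} {y} e = remQuot-injective {m} 8
    (toℕ-injective (cong (proj₂ ∘ proj₂) e))
    (trans (sym (unbits-bits _)) (trans (cong (λ z → unbits (proj₁ z , proj₁ (proj₂ z))) e) (unbits-bits _)))

  ∑-decode : ∀ (f : Point → ℕ) → ∑[ y ∈ allFin (m * 8) ] f (decode y) ≡ ∑ points f
  ∑-decode f = begin
    ∑[ y ∈ allFin (m * 8) ] f (decode y)
      ≡⟨ ∑-allFin-* m 8 (f ∘ decode) ⟩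
    ∑[ i ∈ allFin m ] ∑[ e ∈ allFin 8 ] f (decode (combine i e))
      ≡⟨ ∑-cong (allFin m) (λ i → ∑-cong (allFin 8) (λ e →
           cong (λ z → f (proj₁ (bits (proj₂ z)) , proj₂ (bits (proj₂ z)) , toℕ (proj₁ z))) (remQuot-combine i e))) ⟩
    ∑[ i ∈ allFin m ] ∑[ e ∈ allFin 8 ] f (proj₁ (bits e) , proj₂ (bits e) , toℕ i)
      ≡⟨ ∑-swap (allFin m) (allFin 8) (λ i e → f (proj₁ (bits e) , proj₂ (bits e) , toℕ i)) ⟩
    ∑[ e ∈ allFin 8 ] ∑[ i ∈ allFin m ] f (proj₁ (bits e) , proj₂ (bits e) , toℕ i)
      ≡⟨ ∑-cong (allFin 8) (λ e → ∑-allFin-toℕ m (λ x → f (proj₁ (bits e) , proj₂ (bits e) , x))) ⟩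
    ∑[ e ∈ allFin 8 ] ∑[ x ∈ upTo m ] f (proj₁ (bits e) , proj₂ (bits e) , x)
      ≡⟨ ∑-bits (λ c → ∑[ x ∈ upTo m ] f (proj₁ c , proj₂ c , x)) ⟩
    ∑[ a₁ ∈ bools ] ∑[ a₂ ∈ bools ] ∑[ p ∈ bools ] ∑[ x ∈ upTo m ] f ((a₁ , a₂) , p , x)
      ≡⟨ ∑-points f ⟨
    ∑ points f ∎
    where open ≡-Reasoning

  N : ℕ
  N = 2 * (m * 8)

  side-of : Fin N → Fin 2
  side-of = quotient (m * 8)

  point : Fin N → Point
  point x = decode (remainder {2} (m * 8) x)

  -- The first argument is the group that receives the quad; the edge goes to the other group.
  pick : Fin 2 → Weight × Weight → Fin 2 → Weight
  pick 0F (Q , e) 0F = Q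
  pick 0F (Q , e) 1F = e
  pick 1F (Q , e) 0F = e
  pick 1F (Q , e) 1F = Q

  place : Fin 2 → Weight × Weight → Fin N → ℕ
  place o B x = pick o B (side-of x) (point x)

  -- The two positions of the quads use different values of `μ`, as `balance` requires.
  weights : List (Fin N → ℕ)
  weights = map (place 0F) (half false) ++ map (place 1F) (half true)

  ∑-weights : ∀ f → ∑ weights f ≡ ∑[ B ∈ half false ] f (place 0F B) + ∑[ B ∈ half true ] f (place 1F B)
  ∑-weights f = trans (∑-++ (map (place 0F) (half false)) _ f) (cong₂ _+_ (∑-map _ (half false) f) (∑-map _ (half true) f))

  All-weights : ∀ {P : (Fin N → ℕ) → Set} → (∀ o {B} → ProperBlock B → P (place o B)) → All P weights
  All-weights p = Allₚ.++⁺ (Allₚ.map⁺ (All.map (p 0F) (half-proper false))) (Allₚ.map⁺ (All.map (p 1F) (half-proper true)))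

  ∑-place : ∀ (F : Fin 2 → Point → ℕ) → ∑[ x ∈ allFin N ] F (side-of x) (point x) ≡ ∑ points (F 0F) + ∑ points (F 1F)
  ∑-place F = trans (∑-allFin-* 2 (m * 8) _) (trans
    (∑-cong (allFin 2) (λ g → trans
      (∑-cong (allFin (m * 8)) (λ y → cong (λ z → F (proj₁ z) (decode (proj₂ z))) (remQuot-combine g y))) (∑-decode (F g))))
    (cong (∑ points (F 0F) +_) (+-identityʳ _)))

  place≤1 : ∀ o {B} → ProperBlock B → ∀ x → place o B x ≤ 1
  place≤1 o {B} (pQ , pe) x = go o (side-of x)
    where
    go : ∀ o g → pick o B g (point x) ≤ 1
    go 0F 0F = Proper.≤1 pQ (decode-valid _)
    go 0F 1F = Proper.≤1 pe (decode-valid _)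
    go 1F 0F = Proper.≤1 pe (decode-valid _)
    go 1F 1F = Proper.≤1 pQ (decode-valid _)

  weights≤1 : All (λ w → ∀ x → w x ≤ 1) weights
  weights≤1 = All-weights place≤1

  block-size : ∀ o {B} → ProperBlock B → ∣ support (place o B) ∣ ≡ 6
  block-size o {B} pB@(pQ , pe) = trans (∣support∣ (place≤1 o pB)) (trans (∑-place (pick o B)) (go o))
    where
    go : ∀ o → ∑ points (pick o B 0F) + ∑ points (pick o B 1F) ≡ 6
    go 0F = cong₂ _+_ (Proper.size pQ) (Proper.size pe)
    go 1F = cong₂ _+_ (Proper.size pe) (Proper.size pQ)

  trace-size : ∀ o {B} → ProperBlock B → ∀ i → ∣ support (place o B) ∩ fibre side-of i ∣ ≡ ∑ points (pick o B i)
  trace-size o {B} pB i = trans (∣support∩∣ (place≤1 o pB) (λ x → does (side-of x Fin.≟ i)))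
    (trans (∑-place (λ g z → pick o B g z * ind (does (g Fin.≟ i)))) (go i))
    where
    keep : ∀ g → ∑ points (λ z → pick o B g z * 1) ≡ ∑ points (pick o B g)
    keep g = ∑-cong points (λ z → *-identityʳ _)
    drop : ∀ g → ∑ points (λ z → pick o B g z * 0) ≡ 0
    drop g = trans (∑-cong points (λ z → *-zeroʳ (pick o B g z))) (∑-zero points)
    go : ∀ i → ∑ points (λ z → pick o B 0F z * ind (does (0F Fin.≟ i))) + ∑ points (λ z → pick o B 1F z * ind (does (1F Fin.≟ i))) ≡
               ∑ points (pick o B i)
    go 0F = trans (cong₂ _+_ (keep 0F) (drop 1F)) (+-identityʳ _)
    go 1F = cong₂ _+_ (drop 0F) (keep 1F)

  configuration : ∀ o {B} → ProperBlock B → ∃₂ λ i j → i ≢ j ×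
    ∣ support (place o B) ∩ fibre side-of i ∣ ≡ 2 × ∣ support (place o B) ∩ fibre side-of j ∣ ≡ 4
  configuration 0F pB@(pQ , pe) = 1F , 0F , (λ ()) , trans (trace-size 0F pB 1F) (Proper.size pe) , trans (trace-size 0F pB 0F) (Proper.size pQ)
  configuration 1F pB@(pQ , pe) = 0F , 1F , (λ ()) , trans (trace-size 1F pB 0F) (Proper.size pe) , trans (trace-size 1F pB 1F) (Proper.size pQ)

  side-size : ∀ i → ∣ fibre side-of i ∣ ≡ m * 8
  side-size i = trans (∣tabulate∣ (λ x → does (side-of x Fin.≟ i))) (trans (∑-place (λ g _ → ind (does (g Fin.≟ i)))) (go i))
    where
    zeros : ∑ points (λ _ → 0) ≡ 0
    zeros = ∑-zero points
    ones : ∑ points (λ _ → 1) ≡ m * 8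
    ones = trans (sym (∑-decode (λ _ → 1))) (trans (∑-allFin-toℕ (m * 8) (λ _ → 1)) (trans (∑-const (m * 8) 1) (*-identityʳ _)))
    go : ∀ i → ∑ points (λ _ → ind (does (0F Fin.≟ i))) + ∑ points (λ _ → ind (does (1F Fin.≟ i))) ≡ m * 8
    go 0F = trans (cong₂ _+_ ones zeros) (+-identityʳ _)
    go 1F = cong₂ _+_ zeros ones

  replications : ℕ
  replications = m * (6 * v + 4 * suc m) + m * (3 * v + 2 * suc m)

  replication-at : ∀ x → ∑ weights (λ w → w x) ≡ replications
  replication-at x = trans (∑-weights _) (go (side-of x))
    where
    go : ∀ g → ∑[ B ∈ half false ] pick 0F B g (point x) + ∑[ B ∈ half true ] pick 1F B g (point x) ≡ replications
    go 0F = cong₂ _+_ (half-quads-at false (decode-valid _)) (half-edges-at true (decode-valid _))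
    go 1F = trans (cong₂ _+_ (half-edges-at false (decode-valid _)) (half-quads-at true (decode-valid _)))
                  (+-comm (m * (3 * v + 2 * suc m)) _)

  -- A group holds the quads of one half and the edges of the other, which gives 6m + m.
  same-side : ∀ x y → x ≢ y → side-of x ≡ side-of y → ∑ weights (λ w → w x * w y) ≡ 7 * m
  same-side x y x≢y e = trans (∑-weights _) (trans
      (cong (λ g → ∑[ B ∈ half false ] (place 0F B x * pick 0F B g (point y)) + ∑[ B ∈ half true ] (place 1F B x * pick 1F B g (point y))) (sym e))
      (go (side-of x)))
    where
    px≢py : point x ≢ point y
    px≢py = λ p → x≢y (remQuot-injective {2} (m * 8) e (decode-injective p))
    lemma : ∀ m → 6 * m + m ≡ 7 * m
    lemma = solve-∀
    lemma′ : ∀ m → m + 6 * m ≡ 7 * m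
    lemma′ = solve-∀
    go : ∀ g → ∑[ B ∈ half false ] (pick 0F B g (point x) * pick 0F B g (point y)) +
               ∑[ B ∈ half true ] (pick 1F B g (point x) * pick 1F B g (point y)) ≡ 7 * m
    go 0F = trans (cong₂ _+_ (half-quads unit-3 false (decode-valid _) (decode-valid _) px≢py)
                             (half-edges true (decode-valid _) (decode-valid _) px≢py)) (lemma m)
    go 1F = trans (cong₂ _+_ (half-edges false (decode-valid _) (decode-valid _) px≢py)
                             (half-quads unit-3 true (decode-valid _) (decode-valid _) px≢py)) (lemma′ m)

  -- The two halves exchange the roles of quad and edge, and by `balance` their meetings add up to
  -- 3. As v = 2m - 1, the value is 8m - 1.
  opposite-sides : ∀ x y → side-of x ≢ side-of y → ∑ weights (λ w → w x * w y) ≡ 3 * v + 2 * suc m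
  opposite-sides x y = λ ne → trans (∑-weights _) (go (side-of x) (side-of y) ne)
    where
    open ≡-Reasoning
    cross : ∀ μ x y → ∑[ B ∈ half μ ] (proj₁ B (point x) * proj₂ B (point y)) ≡ meetings μ (proj₁ (point x)) (proj₁ (point y)) * v + suc m
    cross μ x y = half-cross μ _ _ _ _ _ _ (decode-valid _) (decode-valid _)
    cross′ : ∀ μ x y → ∑[ B ∈ half μ ] (proj₂ B (point x) * proj₁ B (point y)) ≡ meetings μ (proj₁ (point y)) (proj₁ (point x)) * v + suc m
    cross′ μ x y = trans (∑-cong (half μ) (λ B → *-comm (proj₂ B (point x)) _)) (cross μ y x)
    lemma : ∀ a b v m → a * v + suc m + (b * v + suc m) ≡ (a + b) * v + 2 * suc m
    lemma = solve-∀
    total : ∀ a b → meetings false a b * v + suc m + (meetings true b a * v + suc m) ≡ 3 * v + 2 * suc m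
    total a b = trans (lemma (meetings false a b) (meetings true b a) v m) (cong (λ k → k * v + 2 * suc m) (balance a b))
    go : ∀ g g′ → g ≢ g′ → ∑[ B ∈ half false ] (pick 0F B g (point x) * pick 0F B g′ (point y)) +
               ∑[ B ∈ half true ] (pick 1F B g (point x) * pick 1F B g′ (point y)) ≡ 3 * v + 2 * suc m
    go 0F 0F ne = ⊥-elim (ne refl)
    go 1F 1F ne = ⊥-elim (ne refl)
    go 0F 1F _  = trans (cong₂ _+_ (cross false x y) (cross′ true x y)) (total (proj₁ (point x)) (proj₁ (point y)))
    go 1F 0F _  = trans (cong₂ _+_ (cross′ false x y) (cross true x y)) (total (proj₁ (point y)) (proj₁ (point x)))

  -- The indices enter through equations so that they can be given in the forms `7 * n / 8` and
  -- `n ∸ 1`.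
  design : ∀ {λ₁ λ₂} → λ₁ ≡ 7 * m → λ₂ ≡ 3 * v + 2 * suc m → Σ[ D ∈ GDD (m * 8) 2 6 λ₁ λ₂ ] HasConfiguration 2 4 D
  design refl refl = record
    { groupOf         = side-of
    ; groupSize       = side-size
    ; blocks          = map support weights
    ; blockSize       = Allₚ.map⁺ (All-weights block-size)
    ; r               = replications
    ; equireplicate   = λ x → trans (replication≡ weights≤1 x) (replication-at x)
    ; sameGroup       = λ x y x≢y e → trans (concurrence≡ weights≤1 x y) (same-side x y x≢y e)
    ; differentGroups = λ x y ne → trans (concurrence≡ weights≤1 x y) (opposite-sides x y ne)
    } , Allₚ.map⁺ (All-weights configuration)

-- Parameters for n ≡ 16 modulo 24

theorem5p6 : (n : ℕ) → 0 < n → n % 24 ≡ 16 →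
    Σ[ D ∈ GDD n 2 6 (7 * n / 8) (n ∸ 1) ] HasConfiguration 2 4 D
theorem5p6 n _ n%24≡16 = subst (λ n → Σ[ D ∈ GDD n 2 6 (7 * n / 8) (n ∸ 1) ] HasConfiguration 2 4 D) (sym n≡m*8)
  (Assembly.design h m (suc (2 * h)) refl refl (Modular.unit (suc t) 1 (inverse t)) λ₁≡ (λ₂≡ t))
  where
  t h m : ℕ
  t = n / 24
  -- n = 24t + 16 = 8m gives m = 3t + 2, so h = 3t + 1.
  h = suc (t * 3)
  m = suc h
  n≡m*8 : n ≡ m * 8
  n≡m*8 = trans (m≡m%n+[m/n]*n n 24) (trans (cong (_+ t * 24) n%24≡16) (lemma t))
    where
    lemma : ∀ t → 16 + t * 24 ≡ suc (suc (t * 3)) * 8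
    lemma = solve-∀
  -- 3(t + 1) = 1 + m makes t + 1 the inverse of 3 modulo m.
  inverse : ∀ t → 3 * suc t ≡ 1 + 1 * suc (suc (t * 3))
  inverse = solve-∀
  λ₁≡ : 7 * (m * 8) / 8 ≡ 7 * m
  λ₁≡ = trans (cong (_/ 8) (sym (*-assoc 7 m 8))) (m*n/n≡m (7 * m) 8)
  λ₂≡ : ∀ t → suc (suc (t * 3)) * 8 ∸ 1 ≡ 3 * suc (2 * suc (t * 3)) + 2 * suc (suc (suc (t * 3)))
  λ₂≡ t = lemma t
    where
    -- 8m - 1 with the subtraction already computed, since the ring solver does not handle `∸`.
    lemma : ∀ t → 7 + suc (t * 3) * 8 ≡ 3 * suc (2 * suc (t * 3)) + 2 * suc (suc (suc (t * 3)))
    lemma = solve-∀
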